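{- Let $n,s,t\in\mathbb{N}=\{0,1,2,\ldots\}$ with $t$ odd. Then $$E_{2n}(q)-E_{2n+2^st}(q)\equiv [2^s]_{q^t}\ \left(\mathrm{mod}\ (1+q)[2^s]_{q^t}\right)$$ in $\mathbb{Z}[q]$, i.e. $(1+q)[2^s]_{q^t}$ divides $E_{2n}(q)-E_{2n+2^st}(q)-[2^s]_{q^t}$ in $\mathbb{Z}[q]$.
   Context: For $n\in\mathbb{N}$, $(a;q)_n=\prod_{0\le k<n}(1-aq^k)$ (so $(a;q)_0=1$), and $[n]_q=\frac{1-q^n}{1-q}=\sum_{0\le k<n}q^k$; thus $[2^s]_{q^t}=\frac{1-q^{2^st}}{1-q^t}$. The $q$-Euler numbers $E_n(q)$ ($n\in\mathbb{N}$) are defined by the formal power series identity $$\sum_{n=0}^{\infty}E_{n}(q)\frac{x^{n}}{(q;q)_{n}}=\Big(\sum_{n=0}^{\infty}\frac{q^{\binom{2n}{2}}x^{2n}}{(q;q)_{2n}}\Big)^{ -1};$$ they are polynomials in $q$ with integer coefficients. -}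

module Defs where

open import Data.Nat using (ℕ; zero; suc; _*_; _^_; _∸_)
open import Data.Integer using (ℤ; 0ℤ; 1ℤ) renaming (_+_ to _+ℤ_; _*_ to _*ℤ_; -_ to -ℤ_)
open import Data.List using (List; []; _∷_; map; replicate; _++_)
open import Data.List.Relation.Unary.All using (All)
open import Data.Product using (∃)
open import Data.Bool using (Bool; true; false; if_then_else_)
open import Relation.Binary.PropositionalEquality using (_≡_)

-- Polynomials in ℤ[q]: coefficient lists, lowest degree first.
Poly : Set
Poly = List ℤ

infixl 6 _+ᴾ_ _-ᴾ_
infixl 7 _*ᴾ_

_+ᴾ_ : Poly → Poly → Poly
[] +ᴾ g = g
(a ∷ f) +ᴾ [] = a ∷ f
(a ∷ f) +ᴾ (b ∷ g) = (a +ℤ b) ∷ (f +ᴾ g)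

-ᴾ_ : Poly → Poly
-ᴾ f = map -ℤ_ f

_-ᴾ_ : Poly → Poly → Poly
f -ᴾ g = f +ᴾ (-ᴾ g)

scaleᴾ : ℤ → Poly → Poly
scaleᴾ a f = map (a *ℤ_) f

_*ᴾ_ : Poly → Poly → Poly
[] *ᴾ g = []
(a ∷ f) *ᴾ g = scaleᴾ a g +ᴾ (0ℤ ∷ (f *ᴾ g))

0ᴾ : Poly
0ᴾ = []

1ᴾ : Poly
1ᴾ = 1ℤ ∷ []

qᴾ^ : ℕ → Poly
qᴾ^ k = replicate k 0ℤ ++ (1ℤ ∷ [])

IsZeroᴾ : Poly → Set
IsZeroᴾ f = All (_≡ 0ℤ) f

_∣ᴾ_ : Poly → Poly → Set
d ∣ᴾ f = ∃ λ g → IsZeroᴾ (f -ᴾ d *ᴾ g)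

Σᴾ : ℕ → (ℕ → Poly) → Poly
Σᴾ zero f = 0ᴾ
Σᴾ (suc n) f = Σᴾ n f +ᴾ f n

qint : ℕ → ℕ → Poly
qint n t = Σᴾ n (λ k → qᴾ^ (k * t))

-- Gaussian binomial coefficient (q-Pascal rule), equal to (q;q)_n / ((q;q)_k (q;q)_{n-k})
qbinom : ℕ → ℕ → Poly
qbinom n zero = 1ᴾ
qbinom zero (suc k) = 0ᴾ
qbinom (suc n) (suc k) = qbinom n k +ᴾ qᴾ^ (suc k) *ᴾ qbinom n (suc k)

choose2 : ℕ → ℕ
choose2 zero = zero
choose2 (suc m) = m Data.Nat.+ choose2 m

isEven : ℕ → Bool
isEven zero = true
isEven (suc zero) = false
isEven (suc (suc m)) = isEven m

-- coefficient c_k of x^k/(q;q)_k in Σ q^{binom(2n,2)} x^{2n}/(q;q)_{2n}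
cosc : ℕ → Poly
cosc k = if isEven k then qᴾ^ (choose2 k) else 0ᴾ

-- Coefficient comparison in (Σ E_n x^n/(q;q)_n)(Σ c_n x^n/(q;q)_n) = 1 gives
--   E_0 = 1,  E_N = - Σ_{1 ≤ i ≤ N} qbinom N i * c_i * E_{N-i}   (N ≥ 1).
-- Etable n = E_n ∷ E_{n-1} ∷ … ∷ E_0.
private
  step : ℕ → ℕ → List Poly → Poly
  -- step N j (E_{N-1-j} ∷ …) = Σ_{i ≥ j+1} qbinom N i * c_i * E_{N-i}
  step N j [] = 0ᴾ
  step N j (e ∷ es) = qbinom N (suc j) *ᴾ cosc (suc j) *ᴾ e +ᴾ step N (suc j) es

Etable : ℕ → List Poly
Etable zero = 1ᴾ ∷ []
Etable (suc n) = (-ᴾ step (suc n) 0 (Etable n)) ∷ Etable n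

headᴾ : List Poly → Poly
headᴾ [] = 0ᴾ
headᴾ (e ∷ _) = e

qEuler : ℕ → Poly
qEuler n = headᴾ (Etable n)

Odd : ℕ → Set
Odd t = ∃ λ k → t ≡ suc (2 * k)

{-# OPTIONS --safe #-}
module Submission where

-- Put aₖ = (-1;q)ₖ/2 for k > 0 and a₀ = 1. The q-binomial theorem gives Σ aₖ xᵏ/(q;q)ₖ = cos_q(x) · Σ xᵏ/(q;q)ₖ,
-- where cos_q is the series inverted in the definition of Eₙ, hence Σₖ [N,k] aₖ E_{N-k} = 1 for every N.
-- Let m = 2ˢt with s > 0 (for s = 0 only E_{2n} ≡ 1 mod 1+q and E_{odd} = 0 are needed), W = [2ˢ]_{qᵗ},
-- M = (1+q)W, and expand this identity at N + m by q-Vandermonde into terms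
-- [m,i][N,l] q^{i(N-l)} a_{l+i} E_{N+m-l-i}, where l+i may be taken even because E_{odd} = 0. Since
-- (1-qⁱ)[m,i] = (1-qᵐ)[m-1,i-1] and 1-qᵐ is a multiple of W, and
-- since (1+q)(1-qⁱ) divides (1-qᵘ) a_{l+i} for some odd u unless (i,l) = (2,0), every term with i > 0 vanishes mod M,
-- except that one, which is ≡ W. (The factor 1-qᵘ may be cancelled: it divides a power of 2 modulo M, and M has constant
-- coefficient 1.) Subtracting the identity at N leaves Σ_l [N,l] a_l (E_{N-l} - E_{N+m-l}) ≡ W mod M, where the terms
-- with l > 0 vanish by induction, because 1+q divides a_l.

open import Defs
open import Algebra.Bundles using (CommutativeRing)
open import Algebra.Solver.Ring.AlmostCommutativeRing using (_-Raw-AlmostCommutative⟶_; fromCommutativeRing)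
open import Data.Bool using (true; false; not; if_then_else_)
open import Data.Bool.Properties using (not-injective)
open import Data.Empty using (⊥; ⊥-elim)
open import Data.Integer as ℤ using (ℤ; +_; -[1+_]; 0ℤ; 1ℤ)
import Data.Integer.Properties as ℤ
open import Data.Integer.Solver using (module +-*-Solver)
open import Data.List using (List; []; _∷_)
open import Data.List.Relation.Unary.All using ([]; _∷_)
open import Data.Maybe as Maybe using (Maybe)
open import Data.Nat as ℕ using (ℕ; zero; suc; s≤s; z≤n)
open import Data.Nat.Induction using (<-rec)
import Data.Nat.Properties as ℕ
open import Data.Product as Product using (∃; ∃₂; _,_)
open import Relation.Binary.PropositionalEquality as ≡ using (_≡_)
open import Relation.Nullary.Decidable using (dec⇒maybe)
open import Algebra.Properties.CommutativeSemigroup ℕ.+-commutativeSemigroup using (interchange)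

-- Ring solver with integer coefficients over any commutative ring

module IntegerCoefficientSolver {c ℓ} (R : CommutativeRing c ℓ) where
  open CommutativeRing R
  open import Algebra.Properties.Ring ring
  open import Algebra.Properties.Semiring.Mult.TCOptimised semiring
  open import Relation.Binary.Reasoning.Setoid setoid

  fromℤ : ℤ → Carrier
  fromℤ (+ n)    = n × 1#
  fromℤ -[1+ n ] = - (suc n × 1#)

  fromℤ-⊖ : ∀ m n → fromℤ (m ℤ.⊖ n) ≈ m × 1# - n × 1#
  fromℤ-⊖ zero    zero    = sym (-‿inverseʳ 0#)
  fromℤ-⊖ zero    (suc n) = sym (+-identityˡ _)
  fromℤ-⊖ (suc m) zero    = sym (trans (+-congˡ -0#≈0#) (+-identityʳ _))
  fromℤ-⊖ (suc m) (suc n) = begin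
    fromℤ (suc m ℤ.⊖ suc n)                 ≡⟨ ≡.cong fromℤ (ℤ.[1+m]⊖[1+n]≡m⊖n m n) ⟩
    fromℤ (m ℤ.⊖ n)                         ≈⟨ fromℤ-⊖ m n ⟩
    m × 1# - n × 1#                         ≈⟨ +-congʳ (xyx⁻¹≈y 1# (m × 1#)) ⟨
    (1# + m × 1# - 1#) - n × 1#             ≈⟨ +-assoc _ _ _ ⟩
    (1# + m × 1#) + (- 1# - n × 1#)         ≈⟨ +-congˡ (-‿+-comm 1# (n × 1#)) ⟩
    (1# + m × 1#) - (1# + n × 1#)           ≈⟨ +-cong (1+× m 1#) (-‿cong (1+× n 1#)) ⟨
    suc m × 1# - suc n × 1#                 ∎

  fromℤ-neg : ∀ i → fromℤ (ℤ.- i) ≈ - fromℤ i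
  fromℤ-neg (+ zero)  = sym -0#≈0#
  fromℤ-neg (+ suc n) = refl
  fromℤ-neg -[1+ n ]  = sym (-‿involutive _)

  fromℤ-+ : ∀ i j → fromℤ (i ℤ.+ j) ≈ fromℤ i + fromℤ j
  fromℤ-+ (+ m)    (+ n)    = ×-homo-+ 1# m n
  fromℤ-+ (+ m)    -[1+ n ] = fromℤ-⊖ m (suc n)
  fromℤ-+ -[1+ m ] (+ n)    = trans (fromℤ-⊖ n (suc m)) (+-comm _ _)
  fromℤ-+ -[1+ m ] -[1+ n ] = begin
    - (suc (suc (m ℕ.+ n)) × 1#)      ≈⟨ -‿cong (1+× (suc (m ℕ.+ n)) 1#) ⟩
    - (1# + (suc m ℕ.+ n) × 1#)       ≈⟨ -‿cong (+-congˡ (×-homo-+ 1# (suc m) n)) ⟩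
    - (1# + (suc m × 1# + n × 1#))    ≈⟨ -‿cong (trans (sym (+-assoc _ _ _)) (trans (+-congʳ (+-comm _ _)) (+-assoc _ _ _))) ⟩
    - (suc m × 1# + (1# + n × 1#))    ≈⟨ -‿cong (+-congˡ (1+× n 1#)) ⟨
    - (suc m × 1# + suc n × 1#)       ≈⟨ -‿+-comm _ _ ⟨
    - (suc m × 1#) - (suc n × 1#)     ∎

  fromℤ-pos* : ∀ m j → fromℤ (+ m ℤ.* j) ≈ fromℤ (+ m) * fromℤ j
  fromℤ-pos* m (+ n) = begin
    fromℤ (+ m ℤ.* + n)     ≡⟨ ≡.cong fromℤ (ℤ.pos-* m n) ⟨
    (m ℕ.* n) × 1#          ≈⟨ ×1-homo-* m n ⟩
    (m × 1#) * (n × 1#)     ∎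
  fromℤ-pos* m -[1+ n ] = begin
    fromℤ (+ m ℤ.* -[1+ n ])           ≡⟨ ≡.cong fromℤ (ℤ.neg-distribʳ-* (+ m) (+ suc n)) ⟨
    fromℤ (ℤ.- (+ m ℤ.* + suc n))      ≈⟨ fromℤ-neg (+ m ℤ.* + suc n) ⟩
    - fromℤ (+ m ℤ.* + suc n)          ≈⟨ -‿cong (fromℤ-pos* m (+ suc n)) ⟩
    - (fromℤ (+ m) * fromℤ (+ suc n))  ≈⟨ -‿distribʳ-* _ _ ⟩
    fromℤ (+ m) * - fromℤ (+ suc n)    ∎

  fromℤ-* : ∀ i j → fromℤ (i ℤ.* j) ≈ fromℤ i * fromℤ j
  fromℤ-* (+ m)    j = fromℤ-pos* m j
  fromℤ-* -[1+ m ] j = begin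
    fromℤ (-[1+ m ] ℤ.* j)         ≡⟨ ≡.cong fromℤ (ℤ.neg-distribˡ-* (+ suc m) j) ⟨
    fromℤ (ℤ.- (+ suc m ℤ.* j))    ≈⟨ fromℤ-neg (+ suc m ℤ.* j) ⟩
    - fromℤ (+ suc m ℤ.* j)        ≈⟨ -‿cong (fromℤ-pos* (suc m) j) ⟩
    - (fromℤ (+ suc m) * fromℤ j)  ≈⟨ -‿distribˡ-* _ _ ⟩
    - fromℤ (+ suc m) * fromℤ j    ∎

  homomorphism : CommutativeRing.rawRing ℤ.+-*-commutativeRing -Raw-AlmostCommutative⟶ fromCommutativeRing R
  homomorphism = record
    { ⟦_⟧    = fromℤ
    ; +-homo = fromℤ-+
    ; *-homo = fromℤ-*
    ; -‿homo = fromℤ-neg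
    ; 0-homo = refl
    ; 1-homo = refl
    }

  fromℤ-≟ : ∀ i j → Maybe (fromℤ i ≈ fromℤ j)
  fromℤ-≟ i j = Maybe.map (λ i≡j → reflexive (≡.cong fromℤ i≡j)) (dec⇒maybe (i ℤ.≟ j))

  open import Algebra.Solver.Ring _ _ homomorphism fromℤ-≟ public
    using (Polynomial; solve; _:=_; _:+_; _:*_; _:-_; :-_; con)

  :1 : ∀ {n} → Polynomial n
  :1 = con (+ 1)

-- Parity

isEven-suc : ∀ n → isEven (suc n) ≡ not (isEven n)
isEven-suc zero          = ≡.refl
isEven-suc (suc zero)    = ≡.refl
isEven-suc (suc (suc n)) = isEven-suc n

isEven-+ : ∀ m n → isEven (m ℕ.+ n) ≡ (if isEven m then isEven n else not (isEven n))
isEven-+ zero          n = ≡.refl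
isEven-+ (suc zero)    n = isEven-suc n
isEven-+ (suc (suc m)) n = isEven-+ m n

even+⇒even : ∀ m n → isEven m ≡ true → isEven (m ℕ.+ n) ≡ true → isEven n ≡ true
even+⇒even m n m-even m+n-even with isEven m | isEven-+ m n
even+⇒even m n ≡.refl m+n-even | true | eq = ≡.trans (≡.sym eq) m+n-even

odd+⇒odd : ∀ m n → isEven m ≡ false → isEven (m ℕ.+ n) ≡ true → isEven n ≡ false
odd+⇒odd m n m-odd m+n-even with isEven m | isEven-+ m n
odd+⇒odd m n ≡.refl m+n-even | false | eq = not-injective (≡.trans (≡.sym eq) m+n-even)

even+even : ∀ m n → isEven m ≡ true → isEven n ≡ true → isEven (m ℕ.+ n) ≡ true
even+even m n m-even n-even rewrite isEven-+ m n | m-even = n-even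

odd+even : ∀ m n → isEven m ≡ false → isEven n ≡ true → isEven (m ℕ.+ n) ≡ false
odd+even m n m-odd n-even rewrite isEven-+ m n | m-odd | n-even = ≡.refl

isEven-2* : ∀ n → isEven (2 ℕ.* n) ≡ true
isEven-2* zero    = ≡.refl
isEven-2* (suc n) rewrite ℕ.+-suc n (n ℕ.+ 0) = isEven-2* n

even⇒double : ∀ n → isEven n ≡ true → ∃ λ h → n ≡ h ℕ.+ h
even⇒double zero          _ = 0 , ≡.refl
even⇒double (suc (suc n)) n-even with even⇒double n n-even
... | h , ≡.refl = suc h , ≡.cong suc (≡.sym (ℕ.+-suc h h))

-- Gaussian binomial coefficients and q-exponential convolutions

module GaussianBinomial {c ℓ} (R : CommutativeRing c ℓ) (q : CommutativeRing.Carrier R) where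
  open CommutativeRing R
  open IntegerCoefficientSolver R
  open import Algebra.Properties.Semiring.Exp semiring
  open import Relation.Binary.Reasoning.Setoid setoid

  -- Carrying both parts of N = i + j avoids truncated subtraction in the summand.
  ∑ : ℕ → (ℕ → ℕ → Carrier) → Carrier
  ∑ zero    f = f 0 0
  ∑ (suc N) f = f 0 (suc N) + ∑ N (λ i j → f (suc i) j)

  ∑-cong : ∀ N {f g} → (∀ i j → i ℕ.+ j ≡ N → f i j ≈ g i j) → ∑ N f ≈ ∑ N g
  ∑-cong zero    f≈g = f≈g 0 0 ≡.refl
  ∑-cong (suc N) f≈g = +-cong (f≈g 0 (suc N) ≡.refl)
    (∑-cong N λ i j i+j≡N → f≈g (suc i) j (≡.cong suc i+j≡N))

  ∑-+ : ∀ N f g → ∑ N (λ i j → f i j + g i j) ≈ ∑ N f + ∑ N g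
  ∑-+ zero    f g = refl
  ∑-+ (suc N) f g = trans (+-congˡ (∑-+ N _ _))
    (solve 4 (λ a b x y → (a :+ b) :+ (x :+ y) := (a :+ x) :+ (b :+ y)) refl _ _ _ _)

  ∑-*ˡ : ∀ N x f → ∑ N (λ i j → x * f i j) ≈ x * ∑ N f
  ∑-*ˡ zero    x f = refl
  ∑-*ˡ (suc N) x f = trans (+-congˡ (∑-*ˡ N x _)) (sym (distribˡ x _ _))

  ∑-last : ∀ N f → ∑ (suc N) f ≈ ∑ N (λ i j → f i (suc j)) + f (suc N) 0
  ∑-last zero    f = refl
  ∑-last (suc N) f = trans (+-congˡ (∑-last N (λ i j → f (suc i) j))) (sym (+-assoc _ _ _))

  ∑-0 : ∀ N → ∑ N (λ i j → 0#) ≈ 0#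
  ∑-0 zero    = refl
  ∑-0 (suc N) = trans (+-identityˡ _) (∑-0 N)

  -- Both sides run over the triples i + j + k = N; induction on N splits off those with i = 0.
  ∑-assoc : ∀ N (f : ℕ → ℕ → ℕ → Carrier) →
    ∑ N (λ n k → ∑ n (λ i j → f i j k)) ≈ ∑ N (λ i n → ∑ n (λ j k → f i j k))
  ∑-assoc zero    f = refl
  ∑-assoc (suc N) f = begin
    f 0 0 (suc N) + ∑ N (λ n k → f 0 (suc n) k + ∑ n (λ i j → f (suc i) j k))
      ≈⟨ +-congˡ (∑-+ N _ _) ⟩
    f 0 0 (suc N) + (∑ N (λ n k → f 0 (suc n) k) + ∑ N (λ n k → ∑ n (λ i j → f (suc i) j k)))
      ≈⟨ +-assoc _ _ _ ⟨
    ∑ (suc N) (f 0) + ∑ N (λ n k → ∑ n (λ i j → f (suc i) j k))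
      ≈⟨ +-congˡ (∑-assoc N (λ i → f (suc i))) ⟩
    ∑ (suc N) (f 0) + ∑ N (λ i n → ∑ n (f (suc i)))
      ∎

  -- The Gaussian binomial coefficient [i + j choose i].
  B : ℕ → ℕ → Carrier
  B zero    j       = 1#
  B (suc i) zero    = 1#
  B (suc i) (suc j) = B i (suc j) + q ^ suc i * B (suc i) j

  B-zeroʳ : ∀ i → B i 0 ≈ 1#
  B-zeroʳ zero    = refl
  B-zeroʳ (suc i) = refl

  B-cong : ∀ {i i′ j j′} → i ≡ i′ → j ≡ j′ → B i j ≈ B i′ j′
  B-cong ≡.refl ≡.refl = refl

  -- The mirror image of the recursion defining `B`. Both summands of that recursion are expanded by
  -- induction, and the terms are collected again by the recursion itself.
  B-pascal′ : ∀ i j → B (suc i) (suc j) ≈ q ^ suc j * B i (suc j) + B (suc i) j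
  B-pascal′ zero zero = +-comm _ _
  B-pascal′ zero (suc j) = begin
    1# + q ^ 1 * B 1 (suc j)                  ≈⟨ +-congˡ (*-congˡ (B-pascal′ 0 j)) ⟩
    1# + q * 1# * (q ^ suc j * 1# + B 1 j)    ≈⟨ solve 3 (λ x r b →
      :1 :+ x :* :1 :* (r :* :1 :+ b) := x :* r :* :1 :+ (:1 :+ x :* :1 :* b)) refl _ _ _ ⟩
    q * q ^ suc j * 1# + B 1 (suc j)          ∎
  B-pascal′ (suc i) zero = begin
    B (suc i) 1 + q * q ^ suc i * 1#             ≈⟨ +-congʳ (B-pascal′ i 0) ⟩
    (q * 1# * B i 1 + 1#) + q * q ^ suc i * 1#   ≈⟨ solve 3 (λ x p b →
      (x :* :1 :* b :+ :1) :+ x :* p :* :1 := x :* :1 :* (b :+ p :* :1) :+ :1) refl _ _ _ ⟩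
    q ^ 1 * B (suc i) 1 + 1#                     ∎
  B-pascal′ (suc i) (suc j) = begin
    B (suc i) (suc (suc j)) + q ^ suc (suc i) * B (suc (suc i)) (suc j)
      ≈⟨ +-cong (B-pascal′ i (suc j)) (*-congˡ (B-pascal′ (suc i) j)) ⟩
    (q * q ^ suc j * B i (suc (suc j)) + B (suc i) (suc j)) + q * q ^ suc i * (q ^ suc j * B (suc i) (suc j) + B (suc (suc i)) j)
      ≈⟨ solve 6 (λ x p r a b d →
           (x :* r :* a :+ b) :+ x :* p :* (r :* b :+ d) := x :* r :* (a :+ p :* b) :+ (b :+ x :* p :* d)) refl
           q (q ^ suc i) (q ^ suc j) _ _ _ ⟩
    q ^ suc (suc j) * B (suc i) (suc (suc j)) + B (suc (suc i)) (suc j)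
      ∎

  -- The two Pascal rules for `B (suc i) (suc j)` are combined so that `B (suc i) j` cancels.
  B-absorption : ∀ i j → (1# - q ^ suc i) * B (suc i) j ≈ (1# - q ^ suc (i ℕ.+ j)) * B i j
  B-absorption i zero    = *-cong (+-congˡ (-‿cong (^-congʳ q (≡.cong suc (≡.sym (ℕ.+-identityʳ i)))))) (sym (B-zeroʳ i))
  B-absorption i (suc j) = begin
    (1# - q ^ suc i) * B (suc i) (suc j)
      ≈⟨ solve 2 (λ p b → (:1 :- p) :* b := b :- p :* b) refl _ _ ⟩
    B (suc i) (suc j) - q ^ suc i * B (suc i) (suc j)
      ≈⟨ +-congˡ (-‿cong (*-congˡ (B-pascal′ i j))) ⟩
    (B i (suc j) + q ^ suc i * B (suc i) j) - q ^ suc i * (q ^ suc j * B i (suc j) + B (suc i) j)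
      ≈⟨ solve 4 (λ p r a b → (a :+ p :* b) :- p :* (r :* a :+ b) := (:1 :- p :* r) :* a) refl _ _ _ _ ⟩
    (1# - q ^ suc i * q ^ suc j) * B i (suc j)
      ≈⟨ *-congʳ (+-congˡ (-‿cong (^-homo-* q (suc i) (suc j)))) ⟨
    (1# - q ^ suc (i ℕ.+ suc j)) * B i (suc j) ∎

  -- Both sides are the q-trinomial coefficient (q;q)_{i+j+k} / ((q;q)_i (q;q)_j (q;q)_k). A general
  -- ring has no such quotients, so each side is split by Pascal's rule into the three trinomials
  -- with one index lowered.
  B-trinomial : ∀ i j k → B (i ℕ.+ j) k * B i j ≈ B i (j ℕ.+ k) * B j k
  B-trinomial zero    j       k       = *-comm _ _
  B-trinomial (suc i) zero    k       = *-congʳ (B-cong {j = k} (ℕ.+-identityʳ (suc i)) ≡.refl)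
  B-trinomial (suc i) (suc j) zero    = trans (*-comm _ _) (*-congʳ (B-cong {suc i} ≡.refl (≡.sym (ℕ.+-identityʳ (suc j)))))
  B-trinomial (suc i) (suc j) (suc k) = begin
    (B (i ℕ.+ suc j) (suc k) + q ^ suc (i ℕ.+ suc j) * B (suc i ℕ.+ suc j) k) * B (suc i) (suc j)
      ≈⟨ solve 6 (λ x y P z a p → (x :+ P :* y) :* (a :+ p :* z) := x :* a :+ p :* (x :* z) :+ P :* (y :* (a :+ p :* z))) refl _ _ _ _ _ _ ⟩
    B (i ℕ.+ suc j) (suc k) * B i (suc j) + q ^ suc i * (B (i ℕ.+ suc j) (suc k) * B (suc i) j)
      + q ^ suc (i ℕ.+ suc j) * (B (suc i ℕ.+ suc j) k * B (suc i) (suc j))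
      ≈⟨ +-cong (+-cong (B-trinomial i (suc j) (suc k))
           (*-congˡ (trans (*-congʳ (B-cong (ℕ.+-suc i j) ≡.refl)) (B-trinomial (suc i) j (suc k)))))
           (*-cong (^-homo-* q (suc i) (suc j)) (B-trinomial (suc i) (suc j) k)) ⟩
    B i (suc j ℕ.+ suc k) * B (suc j) (suc k) + q ^ suc i * (B (suc i) (j ℕ.+ suc k) * B j (suc k))
      + q ^ suc i * q ^ suc j * (B (suc i) (suc j ℕ.+ k) * B (suc j) k)
      ≈⟨ +-congˡ (*-congˡ (*-congʳ (B-cong {suc i} ≡.refl (≡.sym (ℕ.+-suc j k))))) ⟩
    B i (suc j ℕ.+ suc k) * B (suc j) (suc k) + q ^ suc i * (B (suc i) (j ℕ.+ suc k) * B j (suc k))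
      + q ^ suc i * q ^ suc j * (B (suc i) (j ℕ.+ suc k) * B (suc j) k)
      ≈⟨ solve 6 (λ x p r y a b → x :* (a :+ r :* b) :+ p :* (y :* a) :+ p :* r :* (y :* b) := (x :+ p :* y) :* (a :+ r :* b)) refl _ _ _ _ _ _ ⟩
    (B i (suc j ℕ.+ suc k) + q ^ suc i * B (suc i) (j ℕ.+ suc k)) * B (suc j) (suc k)
      ∎

  -- For f i j = gᵢ hⱼ this is the coefficient of x^N/(q;q)_N in (Σ gᵢ xⁱ/(q;q)ᵢ)(Σ hⱼ xʲ/(q;q)ⱼ).
  conv : ℕ → (ℕ → ℕ → Carrier) → Carrier
  conv N f = ∑ N (λ i j → B i j * f i j)

  conv-cong : ∀ N {f g} → (∀ i j → i ℕ.+ j ≡ N → f i j ≈ g i j) → conv N f ≈ conv N g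
  conv-cong N f≈g = ∑-cong N (λ i j i+j≡N → *-congˡ (f≈g i j i+j≡N))

  conv-+ : ∀ N f g → conv N (λ i j → f i j + g i j) ≈ conv N f + conv N g
  conv-+ N f g = trans (∑-cong N (λ i j _ → distribˡ _ _ _)) (∑-+ N _ _)

  conv-*ˡ : ∀ N x f → conv N (λ i j → x * f i j) ≈ x * conv N f
  conv-*ˡ N x f = trans (∑-cong N (λ i j _ → solve 3 (λ b x f → b :* (x :* f) := x :* (b :* f)) refl _ _ _)) (∑-*ˡ N x _)

  -- Pascal's rule applied to every coefficient at once, with its second summand reindexed. The
  -- inductions behind q-Vandermonde and the q-binomial theorem rest on it.
  conv-suc : ∀ N f → conv (suc N) f ≈ conv N (λ i j → f (suc i) j + q ^ i * f i (suc j))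
  conv-suc N f = begin
    ∑ (suc N) (λ i j → B i j * f i j)
      ≈⟨ +-cong (*-congʳ (sym (*-identityʳ _))) (∑-cong N λ i j _ → trans (*-congʳ (B-split i j)) (distribʳ _ _ _)) ⟩
    C 0 (suc N) * f 0 (suc N) + ∑ N (λ i j → B i j * f (suc i) j + C (suc i) j * f (suc i) j)
      ≈⟨ +-congˡ (∑-+ N _ _) ⟩
    C 0 (suc N) * f 0 (suc N) + (∑ N (λ i j → B i j * f (suc i) j) + ∑ N (λ i j → C (suc i) j * f (suc i) j))
      ≈⟨ solve 3 (λ x y z → x :+ (y :+ z) := y :+ (x :+ z)) refl _ _ _ ⟩
    ∑ N (λ i j → B i j * f (suc i) j) + ∑ (suc N) (λ i j → C i j * f i j)
      ≈⟨ +-congˡ (trans (∑-last N (λ i j → C i j * f i j)) (trans (+-congˡ (zeroˡ _)) (+-identityʳ _))) ⟩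
    ∑ N (λ i j → B i j * f (suc i) j) + ∑ N (λ i j → q ^ i * B i j * f i (suc j))
      ≈⟨ ∑-+ N _ _ ⟨
    ∑ N (λ i j → B i j * f (suc i) j + q ^ i * B i j * f i (suc j))
      ≈⟨ ∑-cong N (λ i j _ → solve 4 (λ b x p y → b :* x :+ p :* b :* y := b :* (x :+ p :* y)) refl _ _ _ _) ⟩
    conv N (λ i j → f (suc i) j + q ^ i * f i (suc j))
      ∎
    where
    -- The second summand of Pascal's rule. Its value 0 at j = 0 extends the rule to `B (suc i) 0`
    -- and kills the last term of the reindexed sum.
    C : ℕ → ℕ → Carrier
    C i zero    = 0#
    C i (suc j) = q ^ i * B i j

    B-split : ∀ i j → B (suc i) j ≈ B i j + C (suc i) j
    B-split i zero    = sym (trans (+-identityʳ _) (B-zeroʳ i))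
    B-split i (suc j) = refl

  -- The q-Vandermonde identity [N+m,k] = Σ_{i+l=k} [m,i] [N,l] q^{i(N-l)}, paired with an arbitrary
  -- `f`. Induction on N: `conv-suc` strips one unit from the outer order and, read backwards, puts
  -- it on the inner one.
  conv-vandermonde : ∀ N m f →
    conv (N ℕ.+ m) f ≈ conv m (λ i j → conv N (λ l r → q ^ (i ℕ.* r) * f (l ℕ.+ i) (r ℕ.+ j)))
  conv-vandermonde zero    m f = conv-cong m λ i j _ → sym (trans (*-identityˡ _)
    (trans (*-congʳ (^-congʳ q (ℕ.*-zeroʳ i))) (*-identityˡ _)))
  conv-vandermonde (suc N) m f = begin
    conv (suc (N ℕ.+ m)) f
      ≈⟨ conv-suc (N ℕ.+ m) f ⟩
    conv (N ℕ.+ m) (λ i j → f (suc i) j + q ^ i * f i (suc j))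
      ≈⟨ conv-vandermonde N m _ ⟩
    conv m (λ i j → conv N (λ l r →
      q ^ (i ℕ.* r) * (f (suc (l ℕ.+ i)) (r ℕ.+ j) + q ^ (l ℕ.+ i) * f (l ℕ.+ i) (suc (r ℕ.+ j)))))
      ≈⟨ conv-cong m (λ i j _ → trans (conv-cong N (λ l r _ → regroup i l r _ _))
           (sym (conv-suc N (λ l r → q ^ (i ℕ.* r) * f (l ℕ.+ i) (r ℕ.+ j))))) ⟩
    conv m (λ i j → conv (suc N) (λ l r → q ^ (i ℕ.* r) * f (l ℕ.+ i) (r ℕ.+ j)))
      ∎
    where
    regroup : ∀ i l r x y →
      q ^ (i ℕ.* r) * (x + q ^ (l ℕ.+ i) * y) ≈ q ^ (i ℕ.* r) * x + q ^ l * (q ^ (i ℕ.* suc r) * y)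
    regroup i l r x y = begin
      q ^ (i ℕ.* r) * (x + q ^ (l ℕ.+ i) * y)
        ≈⟨ *-congˡ (+-congˡ (*-congʳ (^-homo-* q l i))) ⟩
      q ^ (i ℕ.* r) * (x + q ^ l * q ^ i * y)
        ≈⟨ solve 5 (λ a x b d y → a :* (x :+ b :* d :* y) := a :* x :+ b :* ((d :* a) :* y)) refl _ _ _ _ _ ⟩
      q ^ (i ℕ.* r) * x + q ^ l * ((q ^ i * q ^ (i ℕ.* r)) * y)
        ≈⟨ +-congˡ (*-congˡ (*-congʳ (^-homo-* q i (i ℕ.* r)))) ⟨
      q ^ (i ℕ.* r) * x + q ^ l * (q ^ (i ℕ.+ i ℕ.* r) * y)
        ≈⟨ +-congˡ (*-congˡ (*-congʳ (^-congʳ q (ℕ.*-suc i r)))) ⟨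
      q ^ (i ℕ.* r) * x + q ^ l * (q ^ (i ℕ.* suc r) * y)
        ∎

  conv-assoc : ∀ N (f : ℕ → ℕ → ℕ → Carrier) →
    conv N (λ n k → conv n (λ i j → f i j k)) ≈ conv N (λ i n → conv n (λ j k → f i j k))
  conv-assoc N f = begin
    ∑ N (λ n k → B n k * ∑ n (λ i j → B i j * f i j k))
      ≈⟨ ∑-cong N (λ n k _ → trans (sym (∑-*ˡ n _ _)) (∑-cong n (λ { i j ≡.refl → sym (*-assoc _ _ _) }))) ⟩
    ∑ N (λ n k → ∑ n (λ i j → B (i ℕ.+ j) k * B i j * f i j k))
      ≈⟨ ∑-assoc N _ ⟩
    ∑ N (λ i n → ∑ n (λ j k → B (i ℕ.+ j) k * B i j * f i j k))
      ≈⟨ ∑-cong N (λ i n _ → trans (∑-cong n (λ { j k ≡.refl →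
           trans (*-congʳ (B-trinomial i j k)) (*-assoc _ _ _) })) (∑-*ˡ n _ _)) ⟩
    ∑ N (λ i n → B i n * ∑ n (λ j k → B j k * f i j k))
      ∎

  -- (-q;q)ₙ
  P : ℕ → Carrier
  P zero    = 1#
  P (suc n) = P n * (1# + q ^ suc n)

  -- Coefficients of the even and odd parts of (-x;q)∞ = Σ q^binom(k,2) xᵏ/(q;q)ₖ; the even part is
  -- cos_q.
  cosᵉ cosᵒ : ℕ → Carrier
  cosᵉ k = if isEven k then q ^ choose2 k else 0#
  cosᵒ k = if isEven k then 0# else q ^ choose2 k

  cosᵉ-suc : ∀ k → cosᵉ (suc k) ≈ q ^ k * cosᵒ k
  cosᵉ-suc k with isEven (suc k) | isEven k | isEven-suc k
  ... | false | true  | _ = sym (zeroʳ _)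
  ... | true  | false | _ = ^-homo-* q k (choose2 k)

  cosᵒ-suc : ∀ k → cosᵒ (suc k) ≈ q ^ k * cosᵉ k
  cosᵒ-suc k with isEven (suc k) | isEven k | isEven-suc k
  ... | true  | false | _ = sym (zeroʳ _)
  ... | false | true  | _ = ^-homo-* q k (choose2 k)

  private
    conv-const-suc : ∀ N {g h : ℕ → Carrier} → (∀ j → g (suc j) ≈ q ^ j * h j) →
      conv (suc N) (λ i j → g j) ≈ conv N (λ i j → g j) + q ^ N * conv N (λ i j → h j)
    conv-const-suc N {g} {h} g-suc = begin
      conv (suc N) (λ i j → g j)
        ≈⟨ conv-suc N (λ i j → g j) ⟩
      conv N (λ i j → g j + q ^ i * g (suc j))
        ≈⟨ conv-cong N (λ { i j ≡.refl → +-congˡ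
             (trans (*-congˡ (g-suc j)) (trans (sym (*-assoc _ _ _)) (*-congʳ (sym (^-homo-* q i j))))) }) ⟩
      conv N (λ i j → g j + q ^ N * h j)
        ≈⟨ conv-+ N _ _ ⟩
      conv N (λ i j → g j) + conv N (λ i j → q ^ N * h j)
        ≈⟨ +-congˡ (conv-*ˡ N _ _) ⟩
      conv N (λ i j → g j) + q ^ N * conv N (λ i j → h j)
        ∎

  -- The q-binomial theorem at x = 1 and x = -1: the total is (-1;q)_{N+1} = 2 `P N` and the
  -- alternating sum is (1;q)_{N+1} = 0, so both halves equal `P N`. The step from N to N + 1 adds
  -- to each half a multiple of the other, so the two are proved together, without dividing by 2.
  conv-cosᵉ : ∀ N → conv (suc N) (λ i j → cosᵉ j) ≈ P N
  conv-cosᵒ : ∀ N → conv (suc N) (λ i j → cosᵒ j) ≈ P N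
  conv-cosᵉ zero    = trans (conv-const-suc 0 {cosᵉ} {cosᵒ} cosᵉ-suc)
    (solve 0 (:1 :* :1 :+ :1 :* (:1 :* con (+ 0)) := :1) refl)
  conv-cosᵉ (suc N) = trans (conv-const-suc (suc N) {cosᵉ} {cosᵒ} cosᵉ-suc)
    (trans (+-cong (conv-cosᵉ N) (*-congˡ (conv-cosᵒ N)))
           (solve 2 (λ p x → p :+ x :* p := p :* (:1 :+ x)) refl _ _))
  conv-cosᵒ zero    = trans (conv-const-suc 0 {cosᵒ} {cosᵉ} cosᵒ-suc)
    (solve 0 (:1 :* con (+ 0) :+ :1 :* (:1 :* :1) := :1) refl)
  conv-cosᵒ (suc N) = trans (conv-const-suc (suc N) {cosᵒ} {cosᵉ} cosᵒ-suc)
    (trans (+-cong (conv-cosᵒ N) (*-congˡ (conv-cosᵉ N)))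
           (solve 2 (λ p x → p :+ x :* p := p :* (:1 :+ x)) refl _ _))

  -- (-1;q)ₖ / 2 for k > 0, the coefficients of (1 + (-x;q)∞/(x;q)∞) / 2
  a : ℕ → Carrier
  a zero    = 1#
  a (suc k) = P k

  a≈conv-cosᵉ : ∀ k → a k ≈ conv k (λ i j → cosᵉ j)
  a≈conv-cosᵉ zero    = sym (*-identityˡ _)
  a≈conv-cosᵉ (suc k) = sym (conv-cosᵉ k)

  δ : ℕ → Carrier
  δ zero    = 1#
  δ (suc _) = 0#

  conv-δ : ∀ N → conv N (λ i j → δ j) ≈ 1#
  conv-δ zero    = *-identityˡ _
  conv-δ (suc N) = trans (∑-last N (λ i j → B i j * δ j))
    (trans (+-cong (trans (∑-cong N (λ _ _ _ → zeroʳ _)) (∑-0 N)) (*-identityˡ _)) (+-identityˡ _))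

  IsEulerSequence : (ℕ → Carrier) → Set ℓ
  IsEulerSequence E = ∀ N → conv N (λ k j → cosᵉ k * E j) ≈ δ N

  -- With e = Σ xᵏ/(q;q)ₖ and E(x) the series of `E`, this is (e · cos_q) · E(x) = e · (cos_q ·
  -- E(x)) = e.
  conv-a-E : ∀ {E} → IsEulerSequence E → ∀ N → conv N (λ k j → a k * E j) ≈ 1#
  conv-a-E {E} E-rec N = begin
    conv N (λ k j → a k * E j)
      ≈⟨ conv-cong N (λ k j _ → trans (*-comm _ _) (trans (*-congˡ (a≈conv-cosᵉ k)) (sym (conv-*ˡ k (E j) _)))) ⟩
    conv N (λ k j → conv k (λ x y → E j * cosᵉ y))
      ≈⟨ conv-assoc N (λ _ y j → E j * cosᵉ y) ⟩
    conv N (λ x k → conv k (λ y j → E j * cosᵉ y))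
      ≈⟨ conv-cong N (λ x k _ → trans (conv-cong k (λ y j _ → *-comm _ _)) (E-rec k)) ⟩
    conv N (λ x k → δ k)
      ≈⟨ conv-δ N ⟩
    1# ∎

-- Congruences

module QEulerCongruence {c ℓ} (R : CommutativeRing c ℓ) (q : CommutativeRing.Carrier R) where
  open CommutativeRing R
  open IntegerCoefficientSolver R
  open GaussianBinomial R q
  open import Algebra.Properties.Semiring.Exp semiring
  open import Algebra.Properties.Semiring.Divisibility semiring using (_∣0; ∣ʳ-refl)
  open import Algebra.Properties.CommutativeSemigroup.Divisibility *-commutativeSemigroup
    using (_∣_; _,_; ∣ʳ-respʳ-≈; ∣ʳ-respˡ-≈; ∣ʳ-trans; x∣ʳyx; x∣ʳy⇒x∣ʳzy; x∣ʳy⇒xz∣ʳyz; ∙-cong-∣)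
  open import Relation.Binary.Reasoning.Setoid setoid

  ∣-resp : ∀ {d x y} → x ≈ y → d ∣ x → d ∣ y
  ∣-resp = ∣ʳ-respʳ-≈

  ∣-+ : ∀ {d x y} → d ∣ x → d ∣ y → d ∣ x + y
  ∣-+ (a , ad≈x) (b , bd≈y) = a + b , trans (distribʳ _ _ _) (+-cong ad≈x bd≈y)

  ∣-* : ∀ {d x} y → d ∣ x → d ∣ y * x
  ∣-* = x∣ʳy⇒x∣ʳzy

  ∣-neg : ∀ {d x} → d ∣ x → d ∣ - x
  ∣-neg d∣x = ∣-resp (solve 1 (λ x → :- :1 :* x := :- x) refl _) (∣-* (- 1#) d∣x)

  ∣-≈0 : ∀ {d x} → x ≈ 0# → d ∣ x
  ∣-≈0 {d} x≈0 = ∣-resp (sym x≈0) (d ∣0)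

  ∣-*-1 : ∀ {d x y} → d ∣ x - 1# → d ∣ y - 1# → d ∣ x * y - 1#
  ∣-*-1 {x = x} {y} d∣x-1 d∣y-1 = ∣-resp
    (solve 2 (λ x y → y :* (x :- :1) :+ (y :- :1) := x :* y :- :1) refl x y)
    (∣-+ (∣-* y d∣x-1) d∣y-1)

  ∑-∣ : ∀ N {d f} → (∀ i j → i ℕ.+ j ≡ N → d ∣ f i j) → d ∣ ∑ N f
  ∑-∣ zero    d∣f = d∣f 0 0 ≡.refl
  ∑-∣ (suc N) d∣f = ∣-+ (d∣f 0 (suc N) ≡.refl) (∑-∣ N λ i j eq → d∣f (suc i) j (≡.cong suc eq))

  ∑-head : ∀ N {d} f → (∀ i j → suc i ℕ.+ j ≡ N → d ∣ f (suc i) j) → d ∣ ∑ N f - f 0 N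
  ∑-head zero    f d∣f = ∣-≈0 (-‿inverseʳ _)
  ∑-head (suc N) f d∣f = ∣-resp (solve 2 (λ x y → y := (x :+ y) :- x) refl _ _)
    (∑-∣ N λ i j eq → d∣f i j (≡.cong suc eq))

  conv-head : ∀ N {d} f → (∀ i j → suc i ℕ.+ j ≡ N → d ∣ f (suc i) j) → d ∣ conv N f - f 0 N
  conv-head N f d∣f = ∣-resp (+-congˡ (-‿cong (*-identityˡ _)))
    (∑-head N (λ i j → B i j * f i j) (λ i j eq → ∣-* _ (d∣f i j eq)))

  -- The q-integers [n]_{qᵗ} and congruences modulo 1 + q

  bracket : ℕ → ℕ → Carrier
  bracket zero    t = 0#
  bracket (suc n) t = bracket n t + q ^ (n ℕ.* t)

  bracket-telescopes : ∀ n t → (1# - q ^ t) * bracket n t ≈ 1# - q ^ (n ℕ.* t)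
  bracket-telescopes zero    t = trans (zeroʳ _) (sym (-‿inverseʳ _))
  bracket-telescopes (suc n) t = begin
    (1# - q ^ t) * (bracket n t + q ^ (n ℕ.* t))
      ≈⟨ distribˡ _ _ _ ⟩
    (1# - q ^ t) * bracket n t + (1# - q ^ t) * q ^ (n ℕ.* t)
      ≈⟨ +-congʳ (bracket-telescopes n t) ⟩
    (1# - q ^ (n ℕ.* t)) + (1# - q ^ t) * q ^ (n ℕ.* t)
      ≈⟨ solve 2 (λ x y → (:1 :- x) :+ (:1 :- y) :* x := :1 :- y :* x) refl _ _ ⟩
    1# - q ^ t * q ^ (n ℕ.* t)
      ≈⟨ +-congˡ (-‿cong (^-homo-* q t (n ℕ.* t))) ⟨
    1# - q ^ (suc n ℕ.* t) ∎

  bracket-+ : ∀ n m t → bracket (n ℕ.+ m) t ≈ bracket m t + q ^ (m ℕ.* t) * bracket n t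
  bracket-+ zero    m t = sym (trans (+-congˡ (zeroʳ _)) (+-identityʳ _))
  bracket-+ (suc n) m t = begin
    bracket (n ℕ.+ m) t + q ^ ((n ℕ.+ m) ℕ.* t)
      ≈⟨ +-cong (bracket-+ n m t) (trans (^-congʳ q (ℕ.*-distribʳ-+ t n m)) (^-homo-* q (n ℕ.* t) (m ℕ.* t))) ⟩
    (bracket m t + q ^ (m ℕ.* t) * bracket n t) + q ^ (n ℕ.* t) * q ^ (m ℕ.* t)
      ≈⟨ solve 4 (λ a x b y → (a :+ x :* b) :+ y :* x := a :+ x :* (b :+ y)) refl _ _ _ _ ⟩
    bracket m t + q ^ (m ℕ.* t) * bracket (suc n) t ∎

  -- Iteration factors [2ˢ]_{qᵗ} into terms 1 + qʰ, which are treated one by one in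
  -- `coprime-bracket`.
  bracket-double : ∀ s t → bracket (2 ℕ.^ suc s) t ≈ (1# + q ^ (2 ℕ.^ s ℕ.* t)) * bracket (2 ℕ.^ s) t
  bracket-double s t rewrite ℕ.+-identityʳ (2 ℕ.^ s) =
    trans (bracket-+ (2 ℕ.^ s) (2 ℕ.^ s) t) (solve 2 (λ b x → b :+ x :* b := (:1 :+ x) :* b) refl _ _)

  -- With x = qʰ, x^(u+2) - x^u = x^u (x - 1)(1 + x), so the claim passes from u to u + 2, starting
  -- at u = 1.
  1+q^h∣1+q^uh : ∀ u h → isEven u ≡ false → 1# + q ^ h ∣ 1# + q ^ (u ℕ.* h)
  1+q^h∣1+q^uh (suc zero)    h _ rewrite ℕ.+-identityʳ h = ∣ʳ-refl
  1+q^h∣1+q^uh (suc (suc u)) h u-odd = ∣-resp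
    (begin
      q ^ (u ℕ.* h) * (q ^ h - 1#) * (1# + q ^ h) + (1# + q ^ (u ℕ.* h))
        ≈⟨ solve 2 (λ x y → y :* (x :- :1) :* (:1 :+ x) :+ (:1 :+ y) := :1 :+ x :* (x :* y)) refl _ _ ⟩
      1# + q ^ h * (q ^ h * q ^ (u ℕ.* h))
        ≈⟨ +-congˡ (*-congˡ (^-homo-* q h (u ℕ.* h))) ⟨
      1# + q ^ h * q ^ (h ℕ.+ u ℕ.* h)
        ≈⟨ +-congˡ (^-homo-* q h (h ℕ.+ u ℕ.* h)) ⟨
      1# + q ^ (suc (suc u) ℕ.* h) ∎)
    (∣-+ (x∣ʳyx _ _) (1+q^h∣1+q^uh u h u-odd))

  1+q∣q^n-1 : ∀ n → isEven n ≡ true → 1# + q ∣ q ^ n - 1#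
  1+q∣q^n-1 zero          _      = ∣-≈0 (-‿inverseʳ _)
  1+q∣q^n-1 (suc (suc n)) n-even = ∣-resp
    (solve 2 (λ q x → x :* (q :- :1) :* (:1 :+ q) :+ (x :- :1) := q :* (q :* x) :- :1) refl q _)
    (∣-+ (x∣ʳyx _ _) (1+q∣q^n-1 n n-even))

  -- `B 1 n` is 1 + q + ... + qⁿ, whose terms are alternately 1 and -1 modulo 1 + q; an even n
  -- leaves 1.
  1+q∣B-1 : ∀ n → isEven n ≡ true → 1# + q ∣ B 1 n - 1#
  1+q∣B-1 zero          _      = ∣-≈0 (-‿inverseʳ _)
  1+q∣B-1 (suc (suc n)) n-even = ∣-resp
    (solve 2 (λ q b → q :* (:1 :+ q) :+ q :* q :* (b :- :1) :=
      (:1 :+ q :* :1 :* (:1 :+ q :* :1 :* b)) :- :1) refl q (B 1 n))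
    (∣-+ (x∣ʳyx _ _) (∣-* _ (1+q∣B-1 n n-even)))

  -- Coprimality up to powers of 2

  2# : Carrier
  2# = 1# + 1#

  -- `g` becomes a unit modulo `d` once 2 is inverted.
  CoprimeUpTo2 : Carrier → Carrier → Set _
  CoprimeUpTo2 g d = ∃₂ λ k x → d ∣ g * x - 2# ^ k

  coprime-1 : ∀ g → CoprimeUpTo2 g 1#
  coprime-1 g = 0 , 0# , (_ , *-identityʳ _)

  coprime-resp : ∀ {g d e} → d ≈ e → CoprimeUpTo2 g d → CoprimeUpTo2 g e
  coprime-resp d≈e (k , x , d∣) = k , x , ∣ʳ-respˡ-≈ d≈e d∣

  -- The product of g x - 2ᵏ and g y - 2ˡ is 2ᵏ⁺ˡ minus a multiple of g; the witness is the cofactor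
  -- of g in that multiple.
  coprime-* : ∀ {g d e} → CoprimeUpTo2 g d → CoprimeUpTo2 g e → CoprimeUpTo2 g (d * e)
  coprime-* {g} (k , x , d∣) (l , y , e∣) = k ℕ.+ l , x * 2# ^ l + 2# ^ k * y - g * (x * y) ,
    ∣-resp (trans
      (solve 5 (λ g x y z w → :- ((g :* x :- z) :* (g :* y :- w)) := g :* (x :* w :+ z :* y :- g :* (x :* y)) :- z :* w) refl g x y (2# ^ k) (2# ^ l))
      (+-congˡ (-‿cong (sym (^-homo-* 2# k l)))))
    (∣-neg (∙-cong-∣ d∣ e∣))

  -- For odd u, q^{uh} ≡ -1 modulo 1 + qʰ, so 1 - q^{uh} ≡ 2, while 1 - q^{uh} is a multiple of 1 -
  -- qᵘ with cofactor [h]_{qᵘ}.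
  coprime-1+q^h : ∀ u h → isEven u ≡ false → CoprimeUpTo2 (1# - q ^ u) (1# + q ^ h)
  coprime-1+q^h u h u-odd = 1 , bracket h u , ∣-resp
    (begin
      - (1# + q ^ (u ℕ.* h))
        ≈⟨ solve 1 (λ x → :- (:1 :+ x) := (:1 :- x) :- (:1 :+ :1) :* :1) refl _ ⟩
      (1# - q ^ (u ℕ.* h)) - 2# ^ 1
        ≈⟨ +-congʳ (+-congˡ (-‿cong (^-congʳ q (ℕ.*-comm u h)))) ⟩
      (1# - q ^ (h ℕ.* u)) - 2# ^ 1
        ≈⟨ +-congʳ (bracket-telescopes h u) ⟨
      (1# - q ^ u) * bracket h u - 2# ^ 1 ∎)
    (∣-neg (1+q^h∣1+q^uh u h u-odd))

  coprime-bracket : ∀ u s t → isEven u ≡ false → CoprimeUpTo2 (1# - q ^ u) (bracket (2 ℕ.^ s) t)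
  coprime-bracket u zero    t u-odd = coprime-resp (sym (+-identityˡ _)) (coprime-1 _)
  coprime-bracket u (suc s) t u-odd = coprime-resp (sym (bracket-double s t))
    (coprime-* (coprime-1+q^h u (2 ℕ.^ s ℕ.* t) u-odd) (coprime-bracket u s t u-odd))

  -- If g y ≡ 2ᵏ modulo d, then y (g x) ≡ 2ᵏ x, and `halve` strips the factors 2 one by one.
  coprime-cancel : ∀ {g d x} → (∀ {y} → d ∣ 2# * y → d ∣ y) → CoprimeUpTo2 g d → d ∣ g * x → d ∣ x
  coprime-cancel {g} {d} {x} halve (k , y , d∣) d∣gx = halve^ k (∣-resp
    (solve 4 (λ g x y z → y :* (g :* x) :+ :- (x :* (g :* y :- z)) := z :* x) refl g x y (2# ^ k))
    (∣-+ (∣-* y d∣gx) (∣-neg (∣-* x d∣))))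
    where
    halve^ : ∀ k → d ∣ 2# ^ k * x → d ∣ x
    halve^ zero    = ∣-resp (*-identityˡ _)
    halve^ (suc k) d∣2y = halve^ k (halve (∣-resp (*-assoc _ _ _) d∣2y))

  -- Divisors of (-q;q)ₙ

  P-mono : ∀ d n → P n ∣ P (d ℕ.+ n)
  P-mono zero    n = 1# , *-identityˡ _
  P-mono (suc d) n = ∣-resp (*-comm _ _) (∣-* _ (P-mono d n))

  1+q∣P : ∀ n → 1# + q ∣ P (suc n)
  1+q∣P zero    = 1# , *-congˡ (+-congˡ (sym (*-identityʳ q)))
  1+q∣P (suc n) = ∣-resp (*-comm _ _) (∣-* _ (1+q∣P n))

  -- The divisibility is inherited from h to 2h, since 1 - q²ʰ = (1 - qʰ)(1 + qʰ).
  [1+q][1-q^i]∣P : ∀ i → ∃ λ u → isEven u ≡ false Product.×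
    (1# + q) * (1# - q ^ (3 ℕ.+ i)) ∣ (1# - q ^ u) * P (2 ℕ.+ i)
  [1+q][1-q^i]∣P = <-rec _ go
    where
    go : ∀ i → (∀ {j} → j ℕ.< i → _) → _
    go i rec with isEven (3 ℕ.+ i) in parity
    -- At an odd index, u is that index itself, and 1 + q comes from `P`.
    ... | false = 3 ℕ.+ i , parity , ∣-resp (*-comm _ _) (x∣ʳy⇒xz∣ʳyz _ (1+q∣P (suc i)))
    ... | true with even⇒double (3 ℕ.+ i) parity
    -- Halving stops at index 4, because index 2 lies below the range. Here 1 - q⁴ = (1 - q)(1 +
    -- q)(1 + q²), and the cofactor comes from 1 + q³ = (1 + q)(1 - q + q²).
    ...   | suc (suc zero) , ≡.refl = 1 , ≡.refl , ((1# - q) + q * q ,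
            solve 1 (λ q → ((:1 :- q) :+ q :* q) :* ((:1 :+ q) :* (:1 :- q :* (q :* (q :* (q :* :1))))) :=
              (:1 :- q :* :1) :* (((:1 :* (:1 :+ q :* :1)) :* (:1 :+ q :* (q :* :1))) :* (:1 :+ q :* (q :* (q :* :1))))) refl q)
    -- Here 3 + i = 2(3 + h). The extra factor 1 + q^(3+h) is the last factor of P_{3+h}, which
    -- divides P_{2+i}.
    ...   | suc (suc (suc h)) , ≡.refl with rec {h} (ℕ.m<m+n h (s≤s z≤n))
    ...     | u , u-odd , d∣ = u , u-odd , ∣ʳ-respˡ-≈
      (begin
        (1# + q) * (1# - x) * (1# + x)
          ≈⟨ solve 2 (λ q x → (:1 :+ q) :* (:1 :- x) :* (:1 :+ x) := (:1 :+ q) :* (:1 :- x :* x)) refl q x ⟩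
        (1# + q) * (1# - x * x)
          ≈⟨ *-congˡ (+-congˡ (-‿cong (^-homo-* q (3 ℕ.+ h) (3 ℕ.+ h)))) ⟨
        (1# + q) * (1# - q ^ (3 ℕ.+ h ℕ.+ (3 ℕ.+ h))) ∎)
      (∣ʳ-trans (x∣ʳy⇒xz∣ʳyz (1# + x) d∣) (∣-resp-assoc (P-mono (2 ℕ.+ h) (3 ℕ.+ h))))
      where
      x = q ^ (3 ℕ.+ h)
      ∣-resp-assoc : ∀ {z y w v} → y * w ∣ v → z * y * w ∣ z * v
      ∣-resp-assoc d∣ = ∣ʳ-respˡ-≈ (sym (*-assoc _ _ _)) (∙-cong-∣ ∣ʳ-refl d∣)

  -- The excluded pair is index 2 with l = 0, where a₂ = 1 + q has only one of the two factors 1 + q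
  -- of (1 + q)(1 - q²). At index 2 with l > 0, parity forces l ≥ 2, and the second factor comes
  -- from the 1 + q³ in P₃. Larger indices use that P_{2+i} divides a_{3+i+l}.
  [1+q][1-q^i]∣a : ∀ i l → isEven (suc i ℕ.+ l) ≡ true → (i ≡ 1 → l ≡ 0 → ⊥) →
    ∃ λ u → isEven u ≡ false Product.× (1# + q) * (1# - q ^ suc i) ∣ (1# - q ^ u) * a (suc i ℕ.+ l)
  [1+q][1-q^i]∣a zero          (suc l)       even ≢ = 1 , ≡.refl , ∣-resp (*-comm _ _) (∙-cong-∣ (1+q∣P l) ∣ʳ-refl)
  [1+q][1-q^i]∣a (suc zero)    zero          even ≢ = ⊥-elim (≢ ≡.refl ≡.refl)
  [1+q][1-q^i]∣a (suc zero)    (suc (suc l)) even ≢ = 1 , ≡.refl ,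
    ∣ʳ-trans
      ((1# - q + q * q) * (1# + q * q) ,
        solve 1 (λ q → ((:1 :- q) :+ q :* q) :* (:1 :+ q :* q) :* ((:1 :+ q) :* (:1 :- q :* (q :* :1))) :=
          (:1 :- q :* :1) :* (((:1 :* (:1 :+ q :* :1)) :* (:1 :+ q :* (q :* :1))) :* (:1 :+ q :* (q :* (q :* :1))))) refl q)
      (∙-cong-∣ ∣ʳ-refl (≡.subst (λ n → P 3 ∣ P n) (ℕ.+-comm l 3) (P-mono l 3)))
  [1+q][1-q^i]∣a (suc (suc i)) l             even ≢ with [1+q][1-q^i]∣P i
  ... | u , u-odd , d∣ = u , u-odd ,
    ∣ʳ-trans d∣ (∙-cong-∣ ∣ʳ-refl (≡.subst (λ n → P (2 ℕ.+ i) ∣ P n) (ℕ.+-comm l (2 ℕ.+ i)) (P-mono l (2 ℕ.+ i))))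

  -- Congruences for the inverse series of cos_q

  module EulerSequence (E : ℕ → Carrier) (E-euler : IsEulerSequence E) where

    -- The inverse of an even series is even: in the recurrence at odd N, a term with k > 0 has
    -- either odd k, where `cosᵉ` vanishes, or a smaller odd index of `E`.
    E-odd : ∀ N → isEven N ≡ false → E N ≈ 0#
    E-odd = <-rec _ go
      where
      go : ∀ N → (∀ {j} → j ℕ.< N → isEven j ≡ false → E j ≈ 0#) → isEven N ≡ false → E N ≈ 0#
      go (suc N) rec N-odd = begin
        E (suc N)
          ≈⟨ solve 1 (λ x → x := :1 :* (:1 :* x) :+ con (+ 0)) refl _ ⟩
        B 0 (suc N) * (cosᵉ 0 * E (suc N)) + 0#
          ≈⟨ +-congˡ (trans (∑-cong N term≈0) (∑-0 N)) ⟨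
        conv (suc N) (λ k j → cosᵉ k * E j)
          ≈⟨ E-euler (suc N) ⟩
        0# ∎
        where
        term≈0 : ∀ i j → i ℕ.+ j ≡ N → B (suc i) j * (cosᵉ (suc i) * E j) ≈ 0#
        term≈0 i j ≡.refl with isEven (suc i) in parity
        ... | false = trans (*-congˡ (zeroˡ _)) (zeroʳ _)
        ... | true  = trans (*-congˡ (trans (*-congˡ (rec (s≤s (ℕ.m≤n+m j i)) j-odd)) (zeroʳ _))) (zeroʳ _)
          where
          j-odd : isEven j ≡ false
          j-odd with isEven j in j-parity
          ... | false = ≡.refl
          ... | true  = ≡.trans (≡.sym (even+even (suc i) j parity j-parity)) N-odd

    -- In `conv-a-E` every term with k > 0 vanishes modulo 1 + q: `a 1` = 1 meets an odd-indexed
    -- `E`, and from k = 2 on 1 + q divides `a k`.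
    1+q∣E-1 : ∀ N → isEven N ≡ true → 1# + q ∣ E N - 1#
    1+q∣E-1 N N-even = ∣-resp
      (begin
        - (conv N (λ k j → a k * E j) - 1# * E N)
          ≈⟨ -‿cong (+-congʳ (conv-a-E E-euler N)) ⟩
        - (1# - 1# * E N)
          ≈⟨ solve 1 (λ x → :- (:1 :- :1 :* x) := x :- :1) refl _ ⟩
        E N - 1# ∎)
      (∣-neg (conv-head N (λ k j → a k * E j) term∣))
      where
      term∣ : ∀ i j → suc i ℕ.+ j ≡ N → 1# + q ∣ a (suc i) * E j
      term∣ zero    j ≡.refl = ∣-≈0 (trans (*-congˡ (E-odd j (odd+⇒odd 1 j ≡.refl N-even))) (zeroʳ _))
      term∣ (suc i) j _      = ∣-resp (*-comm _ _) (∣-* _ (1+q∣P i))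

    -- The positive even shift is written `suc (suc m)`, and the odd t of the theorem `suc t`, so
    -- that m + 2 splits as 2 + m without subtraction. `cancel` is all that is kept of the
    -- coprimality of M to 1 - qᵘ.
    module Shift
      (m t : ℕ) (W : Carrier)
      (m-even : isEven m ≡ true)
      (t-even : isEven t ≡ true)
      (W-telescopes : (1# - q ^ suc t) * W ≈ 1# - q ^ suc (suc m))
      (cancel : ∀ u {x} → isEven u ≡ false → (1# + q) * W ∣ (1# - q ^ u) * x → (1# + q) * W ∣ x)
      where

      M : Carrier
      M = (1# + q) * W

      binomial-term∣ : ∀ i j l r → suc i ℕ.+ j ≡ suc (suc m) → isEven (l ℕ.+ r) ≡ true → (i ≡ 1 → l ≡ 0 → ⊥) →
        M ∣ B (suc i) j * (a (l ℕ.+ suc i) * E (r ℕ.+ j))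
      binomial-term∣ i j l r i+j≡m l+r-even ≢ with isEven (l ℕ.+ suc i) in parity
      -- The four indices have an even sum, so an odd index of `a` forces an odd index of `E`.
      ... | false = ∣-≈0 (trans (*-congˡ (trans (*-congˡ (E-odd (r ℕ.+ j) r+j-odd)) (zeroʳ _))) (zeroʳ _))
        where
        r+j-odd : isEven (r ℕ.+ j) ≡ false
        r+j-odd = odd+⇒odd (l ℕ.+ suc i) (r ℕ.+ j) parity
          (≡.trans (≡.cong isEven (interchange l (suc i) r j)) (even+even (l ℕ.+ r) _ l+r-even (≡.trans (≡.cong isEven i+j≡m) m-even)))
      ... | true with [1+q][1-q^i]∣a i l (≡.trans (≡.cong isEven (ℕ.+-comm (suc i) l)) parity) ≢
      -- After multiplication by 1 - qᵘ, the factor `a` yields (1 + q)(1 - q^(i+1)); absorption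
      -- turns (1 - q^(i+1)) `B (suc i) j` into (1 - q^(m+2)) `B i j`, and 1 - q^(m+2) is a multiple
      -- of W.
      ...   | u , u-odd , w , w*≈ = cancel u u-odd (w * (1# - q ^ suc t) * B i j * E (r ℕ.+ j) , (begin
        w * (1# - q ^ suc t) * B i j * E (r ℕ.+ j) * ((1# + q) * W)
          ≈⟨ solve 6 (λ w s b e p W → w :* s :* b :* e :* (p :* W) := w :* p :* (s :* W :* b) :* e) refl _ _ _ _ _ _ ⟩
        w * (1# + q) * ((1# - q ^ suc t) * W * B i j) * E (r ℕ.+ j)
          ≈⟨ *-congʳ (*-congˡ (*-congʳ (trans W-telescopes (+-congˡ (-‿cong (^-congʳ q (≡.sym i+j≡m))))))) ⟩
        w * (1# + q) * ((1# - q ^ (suc i ℕ.+ j)) * B i j) * E (r ℕ.+ j)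
          ≈⟨ *-congʳ (*-congˡ (B-absorption i j)) ⟨
        w * (1# + q) * ((1# - q ^ suc i) * B (suc i) j) * E (r ℕ.+ j)
          ≈⟨ solve 5 (λ w p s b e → w :* p :* (s :* b) :* e := b :* (w :* (p :* s) :* e)) refl _ _ _ _ _ ⟩
        B (suc i) j * (w * ((1# + q) * (1# - q ^ suc i)) * E (r ℕ.+ j))
          ≈⟨ *-congˡ (*-congʳ (trans w*≈ (*-congˡ (reflexive (≡.cong a (ℕ.+-comm (suc i) l)))))) ⟩
        B (suc i) j * ((1# - q ^ u) * a (l ℕ.+ suc i) * E (r ℕ.+ j))
          ≈⟨ solve 4 (λ b g x e → b :* (g :* x :* e) := g :* (b :* (x :* e))) refl _ _ _ _ ⟩
        (1# - q ^ u) * (B (suc i) j * (a (l ℕ.+ suc i) * E (r ℕ.+ j))) ∎))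

      module _ (N : ℕ) (N-even : isEven N ≡ true) where

        inner : ℕ → ℕ → ℕ → ℕ → Carrier
        inner i j l r = q ^ (i ℕ.* r) * (a (l ℕ.+ i) * E (r ℕ.+ j))

        inner-term∣ : ∀ i j l r → suc i ℕ.+ j ≡ suc (suc m) → l ℕ.+ r ≡ N → (i ≡ 1 → l ≡ 0 → ⊥) →
          M ∣ B (suc i) j * inner (suc i) j l r
        inner-term∣ i j l r eq ≡.refl ≢ = ∣-resp
          (solve 3 (λ b x y → x :* (b :* y) := b :* (x :* y)) refl _ _ _)
          (∣-* (q ^ (suc i ℕ.* r)) (binomial-term∣ i j l r eq N-even ≢))

        outer-term∣ : ∀ i j → suc i ℕ.+ j ≡ suc (suc m) → (i ≡ 1 → ⊥) → M ∣ B (suc i) j * conv N (inner (suc i) j)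
        outer-term∣ i j eq ≢ = ∣-resp (conv-*ˡ N _ _)
          (∑-∣ N λ l r l+r≡N → ∣-* _ (inner-term∣ i j l r eq l+r≡N (λ i≡1 _ → ≢ i≡1)))

        -- The only term with i > 0 that survives modulo M is the one with i = 2 and l = 0.
        exceptional-term : M ∣ B 2 m * conv N (inner 2 m) - W
        exceptional-term = ∣-resp
          (begin
            (conv N (λ l r → B 2 m * inner 2 m l r) - B 2 m * inner 2 m 0 N) + (B 2 m * inner 2 m 0 N - W)
              ≈⟨ solve 3 (λ x y z → (x :- y) :+ (y :- z) := x :- z) refl _ _ _ ⟩
            conv N (λ l r → B 2 m * inner 2 m l r) - W
              ≈⟨ +-congʳ (conv-*ˡ N _ _) ⟩
            B 2 m * conv N (inner 2 m) - W ∎)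
          (∣-+ (conv-head N _ (λ l r eq → inner-term∣ 1 m (suc l) r ≡.refl eq (λ _ ())))
               (cancel 1 ≡.refl head∣))
          where
          y = q ^ (2 ℕ.* N)
          e = E (N ℕ.+ m)
          b₁ = B 1 m
          b₂ = B 1 t

          absorption₁ : (1# - q ^ 1) * b₂ ≈ 1# - q ^ suc t
          absorption₁ = trans (B-absorption 0 t) (*-identityʳ _)

          -- The factor 1 - q completes a₂ = 1 + q to 1 - q², so two absorptions turn the product
          -- into (1 - q) b₂ b₁ y e W, where b₂, b₁, y and e are all ≡ 1 modulo 1 + q.
          head∣ : M ∣ (1# - q ^ 1) * (B 2 m * inner 2 m 0 N - W)
          head∣ = ∣-resp
            (begin
              (1# - q ^ 1) * (((b₂ * b₁) * (y * e) - 1#) * W)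
                ≈⟨ solve 5 (λ s b c z W → s :* ((b :* c :* z :- :1) :* W) := (s :* b) :* W :* c :* z :- s :* W) refl _ _ _ _ _ ⟩
              ((1# - q ^ 1) * b₂) * W * b₁ * (y * e) - (1# - q ^ 1) * W
                ≈⟨ +-congʳ (*-congʳ (*-congʳ (trans (*-congʳ absorption₁) W-telescopes))) ⟩
              (1# - q ^ suc (suc m)) * b₁ * (y * e) - (1# - q ^ 1) * W
                ≈⟨ +-congʳ (*-congʳ (B-absorption 1 m)) ⟨
              (1# - q ^ 2) * B 2 m * (y * e) - (1# - q ^ 1) * W
                ≈⟨ solve 5 (λ q b y e W → (:1 :- q :* (q :* :1)) :* b :* (y :* e) :- (:1 :- q :* :1) :* W :=
                     (:1 :- q :* :1) :* (b :* (y :* ((:1 :* (:1 :+ q :* :1)) :* e)) :- W)) refl q _ _ _ _ ⟩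
              (1# - q ^ 1) * (B 2 m * inner 2 m 0 N - W) ∎)
            (∣-* _ (∙-cong-∣ (∣-*-1 (∣-*-1 (1+q∣B-1 t t-even) (1+q∣B-1 m m-even))
                                   (∣-*-1 (1+q∣q^n-1 (2 ℕ.* N) (isEven-2* N))
                                          (1+q∣E-1 (N ℕ.+ m) (even+even N m N-even m-even))))
                             ∣ʳ-refl))

        shifted : Carrier
        shifted = conv N (λ l r → a l * E (r ℕ.+ suc (suc m)))

        shifted≡1-W : M ∣ 1# - shifted - W
        shifted≡1-W = ∣-resp
          (begin
            F 1 (suc m) + (∑ m (λ i j → F (2 ℕ.+ i) j) - F 2 m) + (F 2 m - W)
              ≈⟨ solve 5 (λ z x s y W → x :+ (s :- y) :+ (y :- W) := (z :+ (x :+ s)) :- z :- W) refl (F 0 (suc (suc m))) _ _ _ _ ⟩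
            ∑ (suc (suc m)) F - F 0 (suc (suc m)) - W
              ≈⟨ +-congʳ (+-cong total (-‿cong head)) ⟩
            1# - shifted - W ∎)
          -- In this order: i = 1, i ≥ 3, and i = 2.
          (∣-+ (∣-+ (outer-term∣ 0 (suc m) ≡.refl (λ ()))
                    (∑-head m _ (λ i j eq → outer-term∣ (2 ℕ.+ i) j (≡.cong (λ n → suc (suc n)) eq) (λ ()))))
               exceptional-term)
          where
          F : ℕ → ℕ → Carrier
          F i j = B i j * conv N (inner i j)

          total : ∑ (suc (suc m)) F ≈ 1#
          total = trans (sym (conv-vandermonde N (suc (suc m)) (λ k j → a k * E j))) (conv-a-E E-euler (N ℕ.+ suc (suc m)))

          head : F 0 (suc (suc m)) ≈ shifted
          head = trans (*-identityˡ _) (conv-cong N λ l r _ →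
            trans (*-identityˡ _) (*-congʳ (reflexive (≡.cong a (ℕ.+-identityʳ l)))))

      difference : ℕ → Carrier
      difference N = E N - E (N ℕ.+ suc (suc m))

      difference≡W : ∀ N → isEven N ≡ true → M ∣ difference N - W
      difference≡W = <-rec _ go
        where
        go : ∀ N → (∀ {r} → r ℕ.< N → isEven r ≡ true → M ∣ difference r - W) →
          isEven N ≡ true → M ∣ difference N - W
        go N rec N-even = ∣-resp
          (begin
            - (conv N (λ l r → a l * difference r) - 1# * difference N) + (1# - shifted N N-even - W)
              ≈⟨ +-congʳ (-‿cong (+-congʳ conv-difference)) ⟩
            - ((1# - shifted N N-even) - 1# * difference N) + (1# - shifted N N-even - W)
              ≈⟨ solve 3 (λ x d W → :- (x :- :1 :* d) :+ (x :- W) := d :- W) refl _ _ _ ⟩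
            difference N - W ∎)
          (∣-+ (∣-neg (conv-head N (λ l r → a l * difference r) term∣)) (shifted≡1-W N N-even))
          where
          conv-difference : conv N (λ l r → a l * difference r) ≈ 1# - shifted N N-even
          conv-difference = begin
            conv N (λ l r → a l * difference r)
              ≈⟨ conv-cong N (λ l r _ → solve 3 (λ x y z → x :* (y :- z) := x :* y :+ :- :1 :* (x :* z)) refl _ _ _) ⟩
            conv N (λ l r → a l * E r + - 1# * (a l * E (r ℕ.+ suc (suc m))))
              ≈⟨ trans (conv-+ N _ _) (+-congˡ (conv-*ˡ N _ _)) ⟩
            conv N (λ l r → a l * E r) + - 1# * shifted N N-even
              ≈⟨ +-cong (conv-a-E E-euler N) (solve 1 (λ x → :- :1 :* x := :- x) refl _) ⟩
            1# - shifted N N-even ∎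

          W∣difference : ∀ r → r ℕ.< N → isEven r ≡ true → W ∣ difference r
          W∣difference r r<N r-even = ∣-resp (solve 2 (λ d W → (d :- W) :+ W := d) refl _ _)
            (∣-+ (∣ʳ-trans (x∣ʳyx W (1# + q)) (rec r<N r-even)) ∣ʳ-refl)

          -- An odd r makes both values of `E` zero. For even r also l + 1 is even, hence at least
          -- 2, so 1 + q divides `a (suc l)`, while the induction hypothesis makes W a divisor of
          -- `difference r`.
          term∣ : ∀ l r → suc l ℕ.+ r ≡ N → M ∣ a (suc l) * difference r
          term∣ l r ≡.refl with isEven r in parity
          ... | false = ∣-≈0 (trans (*-congˡ (trans (+-cong (E-odd r parity)
              (-‿cong (E-odd (r ℕ.+ suc (suc m)) (odd+even r (suc (suc m)) parity m-even)))) (-‿inverseʳ _))) (zeroʳ _))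
          term∣ (suc l) r ≡.refl | true = ∙-cong-∣ (1+q∣P l) (W∣difference r (s≤s (ℕ.m≤n+m r (suc l))) parity)
          term∣ zero    r ≡.refl | true with () ← ≡.trans (≡.sym parity) (odd+⇒odd 1 r ≡.refl N-even)

    congruence : ∀ N s t → isEven N ≡ true → isEven t ≡ true →
      (∀ {x} → (1# + q) * bracket (2 ℕ.^ s) (suc t) ∣ 2# * x → (1# + q) * bracket (2 ℕ.^ s) (suc t) ∣ x) →
      (1# + q) * bracket (2 ℕ.^ s) (suc t) ∣ E N - E (N ℕ.+ 2 ℕ.^ s ℕ.* suc t) - bracket (2 ℕ.^ s) (suc t)
    -- For s = 0 the q-integer is 1 and the shifted index is odd, so only E_N ≡ 1 modulo 1 + q
    -- remains.
    congruence N zero t N-even t-even _ = ∣-resp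
      (begin
        (E N - 1#)
          ≈⟨ solve 1 (λ x → x :- :1 := (x :- con (+ 0)) :- (con (+ 0) :+ :1)) refl _ ⟩
        E N - 0# - bracket 1 (suc t)
          ≈⟨ +-congʳ (+-congˡ (-‿cong (E-odd (N ℕ.+ 1 ℕ.* suc t) N+t-odd))) ⟨
        E N - E (N ℕ.+ 1 ℕ.* suc t) - bracket 1 (suc t) ∎)
      (∣ʳ-respˡ-≈ (solve 1 (λ q → :1 :+ q := (:1 :+ q) :* (con (+ 0) :+ :1)) refl q) (1+q∣E-1 N N-even))
      where
      N+t-odd : isEven (N ℕ.+ 1 ℕ.* suc t) ≡ false
      N+t-odd rewrite ℕ.+-identityʳ t | isEven-+ N (suc t) | N-even | isEven-suc t | t-even = ≡.refl
    congruence N (suc s) t N-even t-even halve with 2 ℕ.^ s in 2^s | ℕ.m^n>0 2 s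
    ... | suc k | _ = ∣-resp
      (+-congʳ (+-congˡ (-‿cong (reflexive (≡.cong (λ n → E (N ℕ.+ n)) (≡.sym exponent))))))
      (Shift.difference≡W (p ℕ.+ p) t W p+p-even t-even
        (trans (bracket-telescopes (2 ℕ.* suc k) (suc t)) (+-congˡ (-‿cong (^-congʳ q exponent))))
        (λ u u-odd → coprime-cancel halve (coprime-* (coprime-1+q u u-odd)
          (≡.subst (λ n → CoprimeUpTo2 (1# - q ^ u) (bracket (2 ℕ.* n) (suc t))) 2^s (coprime-bracket u (suc s) (suc t) u-odd))))
        N N-even)
      where
      W = bracket (2 ℕ.* suc k) (suc t)
      -- `suc p` is `suc k ℕ.* suc t`, half of the shift.
      p = t ℕ.+ k ℕ.* suc t

      exponent : 2 ℕ.* suc k ℕ.* suc t ≡ suc (suc (p ℕ.+ p))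
      exponent = ≡.trans (ℕ.*-assoc 2 (suc k) (suc t))
        (≡.cong suc (≡.trans (≡.cong (p ℕ.+_) (ℕ.+-identityʳ (suc p))) (ℕ.+-suc p p)))

      p+p-even : isEven (p ℕ.+ p) ≡ true
      p+p-even = ≡.subst (λ n → isEven (p ℕ.+ n) ≡ true) (ℕ.+-identityʳ p) (isEven-2* p)

      coprime-1+q : ∀ u → isEven u ≡ false → CoprimeUpTo2 (1# - q ^ u) (1# + q)
      coprime-1+q u u-odd = coprime-resp (+-congˡ (*-identityʳ q)) (coprime-1+q^h u 1 u-odd)

-- The ring ℤ[q]

coeff : Poly → ℕ → ℤ
coeff []      n       = 0ℤ
coeff (a ∷ f) zero    = a
coeff (a ∷ f) (suc n) = coeff f n

infix 4 _≈ᴾ_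
-- Lists that differ by trailing zeros are the same polynomial, so equality is coefficientwise; the
-- record lets `f` and `g` be inferred.
record _≈ᴾ_ (f g : Poly) : Set where
  constructor coeffwise
  field coeff-≡ : ∀ n → coeff f n ≡ coeff g n
open _≈ᴾ_

≈ᴾ-refl : ∀ {f} → f ≈ᴾ f
≈ᴾ-refl = coeffwise λ _ → ≡.refl

≈ᴾ-sym : ∀ {f g} → f ≈ᴾ g → g ≈ᴾ f
≈ᴾ-sym (coeffwise p) = coeffwise λ n → ≡.sym (p n)

≈ᴾ-trans : ∀ {f g h} → f ≈ᴾ g → g ≈ᴾ h → f ≈ᴾ h
≈ᴾ-trans (coeffwise p) (coeffwise r) = coeffwise λ n → ≡.trans (p n) (r n)

coeff-+ : ∀ f g n → coeff (f +ᴾ g) n ≡ coeff f n ℤ.+ coeff g n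
coeff-+ []      g       n       = ≡.sym (ℤ.+-identityˡ _)
coeff-+ (a ∷ f) []      n       = ≡.sym (ℤ.+-identityʳ _)
coeff-+ (a ∷ f) (b ∷ g) zero    = ≡.refl
coeff-+ (a ∷ f) (b ∷ g) (suc n) = coeff-+ f g n

coeff-neg : ∀ f n → coeff (-ᴾ f) n ≡ ℤ.- coeff f n
coeff-neg []      n       = ≡.refl
coeff-neg (a ∷ f) zero    = ≡.refl
coeff-neg (a ∷ f) (suc n) = coeff-neg f n

coeff-scale : ∀ a f n → coeff (scaleᴾ a f) n ≡ a ℤ.* coeff f n
coeff-scale a []      n       = ≡.sym (ℤ.*-zeroʳ a)
coeff-scale a (b ∷ f) zero    = ≡.refl
coeff-scale a (b ∷ f) (suc n) = coeff-scale a f n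

coeff-∷* : ∀ a f g n → coeff ((a ∷ f) *ᴾ g) n ≡ a ℤ.* coeff g n ℤ.+ coeff (0ℤ ∷ f *ᴾ g) n
coeff-∷* a f g n = ≡.trans (coeff-+ (scaleᴾ a g) (0ℤ ∷ f *ᴾ g) n) (≡.cong (ℤ._+ _) (coeff-scale a g n))

∷-cong : ∀ {a b f g} → a ≡ b → f ≈ᴾ g → a ∷ f ≈ᴾ b ∷ g
∷-cong a≡b (coeffwise p) = coeffwise λ { zero → a≡b ; (suc n) → p n }

+ᴾ-cong : ∀ {f f′ g g′} → f ≈ᴾ f′ → g ≈ᴾ g′ → f +ᴾ g ≈ᴾ f′ +ᴾ g′
+ᴾ-cong {f} {f′} {g} {g′} (coeffwise p) (coeffwise r) = coeffwise λ n →
  ≡.trans (coeff-+ f g n) (≡.trans (≡.cong₂ ℤ._+_ (p n) (r n)) (≡.sym (coeff-+ f′ g′ n)))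

+ᴾ-assoc : ∀ f g h → (f +ᴾ g) +ᴾ h ≈ᴾ f +ᴾ (g +ᴾ h)
+ᴾ-assoc f g h = coeffwise λ n → begin
  coeff ((f +ᴾ g) +ᴾ h) n                     ≡⟨ ≡.trans (coeff-+ (f +ᴾ g) h n) (≡.cong (ℤ._+ _) (coeff-+ f g n)) ⟩
  (coeff f n ℤ.+ coeff g n) ℤ.+ coeff h n     ≡⟨ ℤ.+-assoc (coeff f n) _ _ ⟩
  coeff f n ℤ.+ (coeff g n ℤ.+ coeff h n)     ≡⟨ ≡.trans (coeff-+ f (g +ᴾ h) n) (≡.cong (ℤ._+_ (coeff f n)) (coeff-+ g h n)) ⟨
  coeff (f +ᴾ (g +ᴾ h)) n                     ∎
  where open ≡.≡-Reasoning

+ᴾ-comm : ∀ f g → f +ᴾ g ≈ᴾ g +ᴾ f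
+ᴾ-comm f g = coeffwise λ n →
  ≡.trans (coeff-+ f g n) (≡.trans (ℤ.+-comm (coeff f n) _) (≡.sym (coeff-+ g f n)))

+ᴾ-identityʳ : ∀ f → f +ᴾ 0ᴾ ≈ᴾ f
+ᴾ-identityʳ f = coeffwise λ n → ≡.trans (coeff-+ f [] n) (ℤ.+-identityʳ _)

-ᴾ-cong : ∀ {f g} → f ≈ᴾ g → -ᴾ f ≈ᴾ -ᴾ g
-ᴾ-cong {f} {g} (coeffwise p) = coeffwise λ n →
  ≡.trans (coeff-neg f n) (≡.trans (≡.cong ℤ.-_ (p n)) (≡.sym (coeff-neg g n)))

-ᴾ-inverseʳ : ∀ f → f +ᴾ (-ᴾ f) ≈ᴾ 0ᴾ
-ᴾ-inverseʳ f = coeffwise λ n → ≡.trans (coeff-+ f (-ᴾ f) n)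
  (≡.trans (≡.cong (ℤ._+_ (coeff f n)) (coeff-neg f n)) (ℤ.+-inverseʳ (coeff f n)))

*ᴾ-congˡ : ∀ f {g g′} → g ≈ᴾ g′ → f *ᴾ g ≈ᴾ f *ᴾ g′
*ᴾ-congˡ []      p = ≈ᴾ-refl
*ᴾ-congˡ (a ∷ f) {g} {g′} p = coeffwise λ n → ≡.trans (coeff-∷* a f g n)
  (≡.trans (≡.cong₂ ℤ._+_ (≡.cong (a ℤ.*_) (coeff-≡ p n)) (coeff-≡ (∷-cong ≡.refl (*ᴾ-congˡ f p)) n))
           (≡.sym (coeff-∷* a f g′ n)))

*ᴾ-zeroʳ : ∀ f → f *ᴾ 0ᴾ ≈ᴾ 0ᴾ
*ᴾ-zeroʳ []      = ≈ᴾ-refl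
*ᴾ-zeroʳ (a ∷ f) = coeffwise λ { zero → ≡.refl ; (suc n) → coeff-≡ (*ᴾ-zeroʳ f) n }

-- The recursion of `_*ᴾ_` transposed to the right factor; it makes commutativity an induction on
-- the left one.
*ᴾ-∷ʳ : ∀ f b g → f *ᴾ (b ∷ g) ≈ᴾ scaleᴾ b f +ᴾ (0ℤ ∷ f *ᴾ g)
*ᴾ-∷ʳ []      b g = coeffwise λ { zero → ≡.refl ; (suc n) → ≡.refl }
*ᴾ-∷ʳ (a ∷ f) b g = coeffwise λ
  { zero    → ≡.cong (ℤ._+ 0ℤ) (ℤ.*-comm a b)
  ; (suc n) → begin
      coeff (scaleᴾ a g +ᴾ f *ᴾ (b ∷ g)) n
        ≡⟨ ≡.trans (coeff-+ (scaleᴾ a g) _ n) (≡.cong₂ ℤ._+_ (coeff-scale a g n) (coeff-≡ (*ᴾ-∷ʳ f b g) n)) ⟩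
      a ℤ.* coeff g n ℤ.+ coeff (scaleᴾ b f +ᴾ (0ℤ ∷ f *ᴾ g)) n
        ≡⟨ ≡.cong (ℤ._+_ (a ℤ.* coeff g n)) (coeff-+ (scaleᴾ b f) (0ℤ ∷ f *ᴾ g) n) ⟩
      a ℤ.* coeff g n ℤ.+ (coeff (scaleᴾ b f) n ℤ.+ coeff (0ℤ ∷ f *ᴾ g) n)
        ≡⟨ solve 3 (λ x y z → x :+ (y :+ z) := y :+ (x :+ z)) ≡.refl (a ℤ.* coeff g n) (coeff (scaleᴾ b f) n) (coeff (0ℤ ∷ f *ᴾ g) n) ⟩
      coeff (scaleᴾ b f) n ℤ.+ (a ℤ.* coeff g n ℤ.+ coeff (0ℤ ∷ f *ᴾ g) n)
        ≡⟨ ≡.cong (ℤ._+_ (coeff (scaleᴾ b f) n)) (coeff-∷* a f g n) ⟨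
      coeff (scaleᴾ b f) n ℤ.+ coeff ((a ∷ f) *ᴾ g) n
        ≡⟨ coeff-+ (scaleᴾ b f) _ n ⟨
      coeff (scaleᴾ b f +ᴾ (a ∷ f) *ᴾ g) n ∎ }
  where
  open ≡.≡-Reasoning
  open +-*-Solver

*ᴾ-comm : ∀ f g → f *ᴾ g ≈ᴾ g *ᴾ f
*ᴾ-comm []      g = ≈ᴾ-sym (*ᴾ-zeroʳ g)
*ᴾ-comm (a ∷ f) g = ≈ᴾ-trans (+ᴾ-cong ≈ᴾ-refl (∷-cong ≡.refl (*ᴾ-comm f g))) (≈ᴾ-sym (*ᴾ-∷ʳ g a f))

*ᴾ-cong : ∀ {f f′ g g′} → f ≈ᴾ f′ → g ≈ᴾ g′ → f *ᴾ g ≈ᴾ f′ *ᴾ g′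
*ᴾ-cong {f} {f′} {g} {g′} p r = ≈ᴾ-trans (*ᴾ-congˡ f r)
  (≈ᴾ-trans (*ᴾ-comm f g′) (≈ᴾ-trans (*ᴾ-congˡ g′ p) (*ᴾ-comm g′ f′)))

*ᴾ-distribʳ : ∀ h f g → (f +ᴾ g) *ᴾ h ≈ᴾ f *ᴾ h +ᴾ g *ᴾ h
*ᴾ-distribʳ h []      g       = ≈ᴾ-refl
*ᴾ-distribʳ h (a ∷ f) []      = ≈ᴾ-sym (+ᴾ-identityʳ _)
*ᴾ-distribʳ h (a ∷ f) (b ∷ g) = coeffwise λ n → begin
  coeff ((a ℤ.+ b ∷ f +ᴾ g) *ᴾ h) n
    ≡⟨ coeff-∷* (a ℤ.+ b) (f +ᴾ g) h n ⟩
  (a ℤ.+ b) ℤ.* coeff h n ℤ.+ coeff (0ℤ ∷ (f +ᴾ g) *ᴾ h) n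
    ≡⟨ ≡.cong (ℤ._+_ ((a ℤ.+ b) ℤ.* coeff h n)) (≡.trans (coeff-≡ (∷-cong ≡.refl (*ᴾ-distribʳ h f g)) n)
         (coeff-+ (0ℤ ∷ f *ᴾ h) (0ℤ ∷ g *ᴾ h) n)) ⟩
  (a ℤ.+ b) ℤ.* coeff h n ℤ.+ (coeff (0ℤ ∷ f *ᴾ h) n ℤ.+ coeff (0ℤ ∷ g *ᴾ h) n)
    ≡⟨ solve 5 (λ a b h x y → (a :+ b) :* h :+ (x :+ y) := (a :* h :+ x) :+ (b :* h :+ y)) ≡.refl
         a b (coeff h n) (coeff (0ℤ ∷ f *ᴾ h) n) (coeff (0ℤ ∷ g *ᴾ h) n) ⟩
  (a ℤ.* coeff h n ℤ.+ coeff (0ℤ ∷ f *ᴾ h) n) ℤ.+ (b ℤ.* coeff h n ℤ.+ coeff (0ℤ ∷ g *ᴾ h) n)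
    ≡⟨ ≡.trans (coeff-+ ((a ∷ f) *ᴾ h) ((b ∷ g) *ᴾ h) n) (≡.cong₂ ℤ._+_ (coeff-∷* a f h n) (coeff-∷* b g h n)) ⟨
  coeff ((a ∷ f) *ᴾ h +ᴾ (b ∷ g) *ᴾ h) n ∎
  where
  open ≡.≡-Reasoning
  open +-*-Solver

0∷-*ᴾ : ∀ f g → (0ℤ ∷ f) *ᴾ g ≈ᴾ 0ℤ ∷ f *ᴾ g
0∷-*ᴾ f g = coeffwise λ n → ≡.trans (coeff-∷* 0ℤ f g n) (ℤ.+-identityˡ _)

scaleᴾ-*ᴾ : ∀ a f g → scaleᴾ a f *ᴾ g ≈ᴾ scaleᴾ a (f *ᴾ g)
scaleᴾ-*ᴾ a []      g = ≈ᴾ-refl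
scaleᴾ-*ᴾ a (b ∷ f) g = coeffwise λ n → begin
  coeff ((a ℤ.* b ∷ scaleᴾ a f) *ᴾ g) n
    ≡⟨ coeff-∷* (a ℤ.* b) (scaleᴾ a f) g n ⟩
  a ℤ.* b ℤ.* coeff g n ℤ.+ coeff (0ℤ ∷ scaleᴾ a f *ᴾ g) n
    ≡⟨ ≡.cong (ℤ._+_ (a ℤ.* b ℤ.* coeff g n)) (≡.trans (coeff-≡ (∷-cong (≡.sym (ℤ.*-zeroʳ a)) (scaleᴾ-*ᴾ a f g)) n)
         (coeff-scale a (0ℤ ∷ f *ᴾ g) n)) ⟩
  a ℤ.* b ℤ.* coeff g n ℤ.+ a ℤ.* coeff (0ℤ ∷ f *ᴾ g) n
    ≡⟨ solve 4 (λ a b g x → a :* b :* g :+ a :* x := a :* (b :* g :+ x)) ≡.refl a b (coeff g n) (coeff (0ℤ ∷ f *ᴾ g) n) ⟩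
  a ℤ.* (b ℤ.* coeff g n ℤ.+ coeff (0ℤ ∷ f *ᴾ g) n)
    ≡⟨ ≡.trans (coeff-scale a ((b ∷ f) *ᴾ g) n) (≡.cong (a ℤ.*_) (coeff-∷* b f g n)) ⟨
  coeff (scaleᴾ a ((b ∷ f) *ᴾ g)) n ∎
  where
  open ≡.≡-Reasoning
  open +-*-Solver

*ᴾ-assoc : ∀ f g h → (f *ᴾ g) *ᴾ h ≈ᴾ f *ᴾ (g *ᴾ h)
*ᴾ-assoc []      g h = ≈ᴾ-refl
*ᴾ-assoc (a ∷ f) g h = ≈ᴾ-trans (*ᴾ-distribʳ h (scaleᴾ a g) (0ℤ ∷ f *ᴾ g))
  (+ᴾ-cong (scaleᴾ-*ᴾ a g h) (≈ᴾ-trans (0∷-*ᴾ (f *ᴾ g) h) (∷-cong ≡.refl (*ᴾ-assoc f g h))))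

coeff-0∷[] : ∀ n → coeff (0ℤ ∷ []) n ≡ 0ℤ
coeff-0∷[] zero    = ≡.refl
coeff-0∷[] (suc n) = ≡.refl

*ᴾ-identityˡ : ∀ f → 1ᴾ *ᴾ f ≈ᴾ f
*ᴾ-identityˡ f = coeffwise λ n → ≡.trans (coeff-∷* 1ℤ [] f n)
  (≡.trans (≡.cong₂ ℤ._+_ (ℤ.*-identityˡ (coeff f n)) (coeff-0∷[] n)) (ℤ.+-identityʳ _))

ℤ[q] : CommutativeRing _ _
ℤ[q] = record
  { Carrier = Poly
  ; _≈_ = _≈ᴾ_
  ; _+_ = _+ᴾ_
  ; _*_ = _*ᴾ_
  ; -_  = -ᴾ_
  ; 0#  = 0ᴾ
  ; 1#  = 1ᴾ
  ; isCommutativeRing = record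
    { isRing = record
      { +-isAbelianGroup = record
        { isGroup = record
          { isMonoid = record
            { isSemigroup = record
              { isMagma = record
                { isEquivalence = record { refl = ≈ᴾ-refl ; sym = ≈ᴾ-sym ; trans = ≈ᴾ-trans }
                ; ∙-cong = +ᴾ-cong }
              ; assoc = +ᴾ-assoc }
            ; identity = (λ _ → ≈ᴾ-refl) , +ᴾ-identityʳ }
          ; inverse = (λ f → ≈ᴾ-trans (+ᴾ-comm (-ᴾ f) f) (-ᴾ-inverseʳ f)) , -ᴾ-inverseʳ
          ; ⁻¹-cong = -ᴾ-cong }
        ; comm = +ᴾ-comm }
      ; *-cong = *ᴾ-cong
      ; *-assoc = *ᴾ-assoc
      ; *-identity = *ᴾ-identityˡ , (λ f → ≈ᴾ-trans (*ᴾ-comm f 1ᴾ) (*ᴾ-identityˡ f))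
      ; distrib = (λ f g h → ≈ᴾ-trans (*ᴾ-comm f (g +ᴾ h)) (≈ᴾ-trans (*ᴾ-distribʳ f g h)
                    (+ᴾ-cong (*ᴾ-comm g f) (*ᴾ-comm h f)))) , *ᴾ-distribʳ }
    ; *-comm = *ᴾ-comm } }

-- The q-Euler polynomials in ℤ[q]

module _ where
  open CommutativeRing ℤ[q] hiding (zero)
  open GaussianBinomial ℤ[q] (qᴾ^ 1)
  open QEulerCongruence ℤ[q] (qᴾ^ 1)
  open import Algebra.Properties.Semiring.Exp semiring using (_^_)
  open import Algebra.Properties.Semiring.Divisibility semiring using (_∣_; _,_; ∣ʳ-respˡ-≈; ∣ʳ-respʳ-≈)

  q^n≈qᴾ^n : ∀ n → qᴾ^ 1 ^ n ≈ qᴾ^ n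
  q^n≈qᴾ^n zero    = refl
  q^n≈qᴾ^n (suc n) = trans (0∷-*ᴾ 1ᴾ (qᴾ^ 1 ^ n)) (∷-cong ≡.refl (trans (*ᴾ-identityˡ _) (q^n≈qᴾ^n n)))

  qint≈bracket : ∀ n t → qint n t ≈ bracket n t
  qint≈bracket zero    t = refl
  qint≈bracket (suc n) t = +-cong (qint≈bracket n t) (sym (q^n≈qᴾ^n (n ℕ.* t)))

  cosc≈cosᵉ : ∀ k → cosc k ≈ cosᵉ k
  cosc≈cosᵉ k with isEven k
  ... | true  = sym (q^n≈qᴾ^n (choose2 k))
  ... | false = refl

  -- The Pascal rule of `qbinom` reaches past the diagonal, where `B` has no entry; these values
  -- must vanish for the case j = 0 of `qbinom≈B`.
  qbinom-overflow : ∀ n d → qbinom n (suc (n ℕ.+ d)) ≈ 0#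
  qbinom-overflow zero    d = refl
  qbinom-overflow (suc n) d = trans (+-cong (qbinom-overflow n d)
    (trans (*-congˡ {qᴾ^ (suc (suc (n ℕ.+ d)))} (≡.subst (λ k → qbinom n (suc k) ≈ 0#) (ℕ.+-suc n d) (qbinom-overflow n (suc d))))
      (zeroʳ (qᴾ^ (suc (suc (n ℕ.+ d)))))))
    (+-identityˡ _)

  qbinom≈B : ∀ i j → qbinom (i ℕ.+ j) i ≈ B i j
  qbinom≈B zero    j       = qbinom-0 j
    where
    qbinom-0 : ∀ n → qbinom n 0 ≈ 1#
    qbinom-0 zero    = refl
    qbinom-0 (suc n) = refl
  qbinom≈B (suc i) zero    = trans
    (+-cong (trans (qbinom≈B i 0) (B-zeroʳ i)) (trans (*-congˡ {qᴾ^ (suc i)} qbinom≈0) (zeroʳ (qᴾ^ (suc i)))))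
    (+-identityʳ _)
    where
    qbinom≈0 : qbinom (i ℕ.+ 0) (suc i) ≈ 0#
    qbinom≈0 = ≡.subst (λ n → qbinom n (suc i) ≈ 0#) (≡.sym (ℕ.+-identityʳ i))
      (≡.subst (λ n → qbinom i (suc n) ≈ 0#) (ℕ.+-identityʳ i) (qbinom-overflow i 0))
  qbinom≈B (suc i) (suc j) = +-cong (qbinom≈B i (suc j)) (*-cong (sym (q^n≈qᴾ^n (suc i)))
    (≡.subst (λ n → qbinom n (suc i) ≈ B (suc i) j) (≡.sym (ℕ.+-suc i j)) (qbinom≈B (suc i) j)))

  -- The recurrence for qEuler is stated in Defs through a private function; unification recovers it here.
  mutual
    recurrenceSum : ℕ → ℕ → List Poly → Poly
    recurrenceSum = _

    qEuler-suc : ∀ n → qEuler (suc n) ≡ -ᴾ recurrenceSum (suc n) 0 (Etable n)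
    -- Turning the arguments into variables gives a pattern unification problem, whose solution is
    -- unique.
    qEuler-suc n with suc n | zero | Etable n
    ... | N | j | es = ≡.refl

  -- `j` counts the table entries already consumed, hence the index `suc (k ℕ.+ j)` after k more.
  recurrenceSum≈∑ : ∀ N j n → recurrenceSum N j (Etable n) ≈
    ∑ n (λ k r → qbinom N (suc (k ℕ.+ j)) * cosc (suc (k ℕ.+ j)) * qEuler r)
  recurrenceSum≈∑ N j zero    = +-identityʳ _
  recurrenceSum≈∑ N j (suc n) = +-congˡ (trans (recurrenceSum≈∑ N (suc j) n)
    (∑-cong n λ k r _ → reflexive
      (≡.cong (λ i → qbinom N (suc i) * cosc (suc i) * qEuler r) (ℕ.+-suc k j))))

  qEuler-isEulerSequence : IsEulerSequence qEuler
  qEuler-isEulerSequence zero    = coeffwise λ { zero → ≡.refl ; (suc zero) → ≡.refl ; (suc (suc n)) → ≡.refl }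
  qEuler-isEulerSequence (suc n) = begin
    1# * (1# ^ 1 * qEuler (suc n)) + rest
      ≈⟨ +-congʳ (trans (*-identityˡ _) (trans (*-congʳ {qEuler (suc n)} (*-identityˡ 1#)) (*-identityˡ _))) ⟩
    qEuler (suc n) + rest
      ≈⟨ +-congʳ (trans (reflexive (qEuler-suc n)) (-‿cong (trans (recurrenceSum≈∑ (suc n) 0 n) (∑-cong n term≈)))) ⟩
    - rest + rest
      ≈⟨ -‿inverseˡ rest ⟩
    0# ∎
    where
    open import Relation.Binary.Reasoning.Setoid setoid
    rest = ∑ n (λ k r → B (suc k) r * (cosᵉ (suc k) * qEuler r))

    term≈ : ∀ k r → k ℕ.+ r ≡ n →
      qbinom (suc n) (suc (k ℕ.+ 0)) * cosc (suc (k ℕ.+ 0)) * qEuler r ≈ B (suc k) r * (cosᵉ (suc k) * qEuler r)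
    term≈ k r ≡.refl rewrite ℕ.+-identityʳ k = trans
      (*-assoc (qbinom (suc (k ℕ.+ r)) (suc k)) (cosc (suc k)) (qEuler r))
      (*-cong (qbinom≈B (suc k) r) (*-congʳ (cosc≈cosᵉ (suc k))))

  -- Cancelling 2 modulo a polynomial with constant coefficient 1

  tail : Poly → Poly
  tail []      = []
  tail (_ ∷ f) = f

  coeff-tail : ∀ f n → coeff (tail f) n ≡ coeff f (suc n)
  coeff-tail []      n = ≡.refl
  coeff-tail (_ ∷ f) n = ≡.refl

  -- The cofactor is even: comparing constant coefficients in w d = 2 x shows that its lowest
  -- coefficient is 2 x₀, and removing x₀ d from x and dividing by q leaves the same equation for
  -- the rest of the cofactor. Half the cofactor is the quotient.
  halve-cofactor : ∀ {d} → coeff d 0 ≡ 1ℤ → ∀ w x → (∀ n → coeff (w * d) n ≡ + 2 ℤ.* coeff x n) → d ∣ x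
  halve-cofactor     d₀≡1 []      x eq = [] , coeffwise λ n → ≡.sym (ℤ.*-cancelˡ-≡ (+ 2) (coeff x n) 0ℤ (≡.sym (eq n)))
  halve-cofactor {d} d₀≡1 (b ∷ w) x eq = quotient
    where
    open ≡.≡-Reasoning
    open +-*-Solver
    x₀ = coeff x 0
    -- Dropping the head is division by q, since x - x₀ d has constant coefficient 0.
    x′ = tail (x - scaleᴾ x₀ d)

    coeff-x′ : ∀ n → coeff x′ n ≡ coeff x (suc n) ℤ.- x₀ ℤ.* coeff d (suc n)
    coeff-x′ n = ≡.trans (coeff-tail (x - scaleᴾ x₀ d) n) (≡.trans (coeff-+ x (-ᴾ scaleᴾ x₀ d) (suc n))
      (≡.cong (ℤ._+_ (coeff x (suc n))) (≡.trans (coeff-neg (scaleᴾ x₀ d) (suc n)) (≡.cong ℤ.-_ (coeff-scale x₀ d (suc n))))))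

    b≡2x₀ : b ≡ + 2 ℤ.* x₀
    b≡2x₀ = begin
      b                                     ≡⟨ solve 1 (λ b → b := b :* con 1ℤ :+ con 0ℤ) ≡.refl b ⟩
      b ℤ.* 1ℤ ℤ.+ 0ℤ                       ≡⟨ ≡.cong (λ y → b ℤ.* y ℤ.+ 0ℤ) d₀≡1 ⟨
      b ℤ.* coeff d 0 ℤ.+ 0ℤ                ≡⟨ coeff-∷* b w d 0 ⟨
      coeff ((b ∷ w) * d) 0                 ≡⟨ eq 0 ⟩
      + 2 ℤ.* x₀                            ∎

    wd≡2x′ : ∀ n → coeff (w * d) n ≡ + 2 ℤ.* coeff x′ n
    wd≡2x′ n = begin
      coeff (w * d) n
        ≡⟨ solve 2 (λ y z → z := (y :+ z) :- y) ≡.refl (b ℤ.* coeff d (suc n)) (coeff (w * d) n) ⟩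
      (b ℤ.* coeff d (suc n) ℤ.+ coeff (w * d) n) ℤ.- b ℤ.* coeff d (suc n)
        ≡⟨ ≡.cong₂ ℤ._-_ (≡.trans (≡.sym (coeff-∷* b w d (suc n))) (eq (suc n))) (≡.cong (ℤ._* coeff d (suc n)) b≡2x₀) ⟩
      + 2 ℤ.* coeff x (suc n) ℤ.- + 2 ℤ.* x₀ ℤ.* coeff d (suc n)
        ≡⟨ solve 3 (λ y z u → con (+ 2) :* y :- con (+ 2) :* z :* u := con (+ 2) :* (y :- z :* u)) ≡.refl (coeff x (suc n)) x₀ (coeff d (suc n)) ⟩
      + 2 ℤ.* (coeff x (suc n) ℤ.- x₀ ℤ.* coeff d (suc n))
        ≡⟨ ≡.cong (+ 2 ℤ.*_) (coeff-x′ n) ⟨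
      + 2 ℤ.* coeff x′ n ∎

    quotient : d ∣ x
    quotient with halve-cofactor d₀≡1 w x′ wd≡2x′
    ... | z , zd≈x′ = x₀ ∷ z , coeffwise λ
      { zero    → begin
          coeff ((x₀ ∷ z) * d) 0    ≡⟨ coeff-∷* x₀ z d 0 ⟩
          x₀ ℤ.* coeff d 0 ℤ.+ 0ℤ   ≡⟨ ≡.cong (λ y → x₀ ℤ.* y ℤ.+ 0ℤ) d₀≡1 ⟩
          x₀ ℤ.* 1ℤ ℤ.+ 0ℤ          ≡⟨ solve 1 (λ b → b :* con 1ℤ :+ con 0ℤ := b) ≡.refl x₀ ⟩
          x₀                        ∎
      ; (suc n) → begin
          coeff ((x₀ ∷ z) * d) (suc n)
            ≡⟨ coeff-∷* x₀ z d (suc n) ⟩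
          x₀ ℤ.* coeff d (suc n) ℤ.+ coeff (z * d) n
            ≡⟨ ≡.cong (ℤ._+_ (x₀ ℤ.* coeff d (suc n))) (≡.trans (coeff-≡ zd≈x′ n) (coeff-x′ n)) ⟩
          x₀ ℤ.* coeff d (suc n) ℤ.+ (coeff x (suc n) ℤ.- x₀ ℤ.* coeff d (suc n))
            ≡⟨ solve 2 (λ y z → y :+ (z :- y) := z) ≡.refl (x₀ ℤ.* coeff d (suc n)) (coeff x (suc n)) ⟩
          coeff x (suc n) ∎ }

  halve : ∀ {d} → coeff d 0 ≡ 1ℤ → ∀ {x} → d ∣ 2# * x → d ∣ x
  halve {d} d₀≡1 {x} (w , wd≈2x) = halve-cofactor d₀≡1 w x λ n → ≡.trans (coeff-≡ wd≈2x n)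
    (≡.trans (coeff-∷* (+ 2) [] x n) (≡.trans (≡.cong (ℤ._+_ (+ 2 ℤ.* coeff x n)) (coeff-0∷[] n)) (ℤ.+-identityʳ _)))

  coeff₀-* : ∀ f g → coeff (f * g) 0 ≡ coeff f 0 ℤ.* coeff g 0
  coeff₀-* []      g = ≡.refl
  coeff₀-* (a ∷ f) g = ≡.trans (coeff-∷* a f g 0) (ℤ.+-identityʳ _)

  coeff₀-bracket : ∀ n t → coeff (bracket (suc n) (suc t)) 0 ≡ 1ℤ
  coeff₀-bracket zero    t = ≡.refl
  coeff₀-bracket (suc n) t = ≡.trans
    (coeff-+ (bracket (suc n) (suc t)) (qᴾ^ 1 * qᴾ^ 1 ^ (t ℕ.+ n ℕ.* suc t)) 0)
    (≡.cong₂ ℤ._+_ (coeff₀-bracket n t) (coeff₀-* (qᴾ^ 1) (qᴾ^ 1 ^ (t ℕ.+ n ℕ.* suc t))))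

  ∣⇒∣ᴾ : ∀ {d f} → d ∣ f → d ∣ᴾ f
  ∣⇒∣ᴾ {d} {f} (w , wd≈f) = w , ≈0⇒IsZero (f - d * w)
    (trans (+-congˡ {f} (-‿cong (trans (*-comm d w) wd≈f))) (-‿inverseʳ f))
    where
    ≈0⇒IsZero : ∀ f → f ≈ 0# → IsZeroᴾ f
    ≈0⇒IsZero []      f≈0 = []
    ≈0⇒IsZero (a ∷ f) f≈0 = coeff-≡ f≈0 0 ∷ ≈0⇒IsZero f (coeffwise λ n → coeff-≡ f≈0 (suc n))

  qEuler-congruence : ∀ n s t → Odd t →
    ((1ᴾ +ᴾ qᴾ^ 1) *ᴾ qint (2 ℕ.^ s) t) ∣ᴾ (qEuler (2 ℕ.* n) -ᴾ qEuler (2 ℕ.* n ℕ.+ 2 ℕ.^ s ℕ.* t) -ᴾ qint (2 ℕ.^ s) t)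
  qEuler-congruence n s t (k , ≡.refl) = ∣⇒∣ᴾ
    (∣ʳ-respˡ-≈ (*-congˡ {1# + qᴾ^ 1} bracket≈) (∣ʳ-respʳ-≈
      (+-congˡ {qEuler (2 ℕ.* n) - qEuler (2 ℕ.* n ℕ.+ 2 ℕ.^ s ℕ.* t)} (-‿cong bracket≈))
      (EulerSequence.congruence qEuler qEuler-isEulerSequence (2 ℕ.* n) s (2 ℕ.* k)
        (isEven-2* n) (isEven-2* k) (halve modulus₀≡1))))
    where
    bracket≈ : bracket (2 ℕ.^ s) t ≈ qint (2 ℕ.^ s) t
    bracket≈ = sym (qint≈bracket (2 ℕ.^ s) t)

    modulus₀≡1 : coeff ((1# + qᴾ^ 1) * bracket (2 ℕ.^ s) t) 0 ≡ 1ℤ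
    modulus₀≡1 with 2 ℕ.^ s | ℕ.m^n>0 2 s
    ... | suc j | _ = ≡.trans (coeff₀-* (1# + qᴾ^ 1) (bracket (suc j) t)) (≡.cong (1ℤ ℤ.*_) (coeff₀-bracket j (2 ℕ.* k)))

open import Data.Nat using (_+_; _*_; _^_)

theorem1p1 : (n s t : ℕ) → Odd t →
    ((1ᴾ +ᴾ qᴾ^ 1) *ᴾ qint (2 ^ s) t) ∣ᴾ (qEuler (2 * n) -ᴾ qEuler (2 * n + 2 ^ s * t) -ᴾ qint (2 ^ s) t)
theorem1p1 = qEuler-congruence
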